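{- Let $G'$ be a graph that is not a disjoint union of copies of $K_2$. Construct a graph $G$ from $G'$ by attaching finitely many (possibly empty) trees to each node of $G'$, at least one of which is not isolated. Then \[ \mathcal{H}_G=\mathcal{H}_{G'},\qquad \mathcal{H}_G^\psi=\mathcal{H}_{G'}^\psi,\qquad \mathcal{H}_G^\phi=\mathcal{H}_{G'}^\phi. \] In particular, if $G$ is a tree with at least $3$ vertices, then $CE_H(G)=CE_H^\phi(G)=CE_H^\psi(G)=1$.
   Context: All graphs are finite and simple; attaching a tree $T$ to a node $v$ means taking the disjoint union with $T$ and identifying a vertex of $T$ with $v$. $K_2$ is the complete graph on $2$ vertices. For a graph $G=(V,E)$ with $V=\{1,\dots,n\}$ and $I\subset\mathbb{R}$, $\mathcal{P}_G(I)$ is the set of real symmetric positive semidefinite $n\times n$ matrices with entries in $I$ such that $a_{ij}=0$ whenever $i\neq j$ and $(i,j)\notin E$; $\mathcal{P}_G:=\mathcal{P}_G(\mathbb{R})$. For $A$ with nonnegative entries, $A^{\circ\alpha}:=(a_{ij}^\alpha)$ with $0^\alpha:=0$. $\psi_\alpha(x)=\mathrm{sgn}(x)|x|^\alpha$, $\phi_\alpha(x)=|x|^\alpha$ for $x\ne0$, $\psi_\alpha(0)=\phi_\alpha(0)=0$, applied entrywise: $f[A]=(f(a_{ij}))$. $\mathcal{H}_G:=\{\alpha\in\mathbb{R}: A^{\circ\alpha}\in\mathcal{P}_G\ \forall A\in\mathcal{P}_G([0,\infty))\}$, $\mathcal{H}_G^\psi:=\{\alpha:\psi_\alpha[A]\in\mathcal{P}_G\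 \forall A\in\mathcal{P}_G(\mathbb{R})\}$, $\mathcal{H}_G^\phi:=\{\alpha:\phi_\alpha[A]\in\mathcal{P}_G\ \forall A\in\mathcal{P}_G(\mathbb{R})\}$. $CE_H(G):=\min\{\alpha: A^{\circ\beta}\in\mathcal{P}_G\ \forall A\in\mathcal{P}_G([0,\infty)),\ \forall\beta\ge\alpha\}$, and analogously $CE_H^\psi(G), CE_H^\phi(G)$ using $\psi_\beta,\phi_\beta$ on $\mathcal{P}_G(\mathbb{R})$.
   Formalization: "Not a disjoint union of copies of K_2" is taken up to isolated vertices (G' is not a disjoint union of copies of K_1 and K_2); literally the claim fails for G' = K_2 ⊔ K_1 with an edge attached to a vertex of K_2, where H changes from [0,∞) to [1,∞). -}

module Defs where

open import Level using (Level; _⊔_; 0ℓ) renaming (suc to lsuc)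
open import Algebra.Bundles using (CommutativeRing)
open import Data.Bool.Base using (if_then_else_)
open import Data.Fin.Base using (Fin)
open import Data.Fin.Properties using (_≟_)
open import Data.List.Base using (_∷_; _∷ʳ_)
open import Data.List.Relation.Unary.Linked using (Linked)
open import Data.List.Relation.Unary.Unique.Propositional using (Unique)
open import Data.Nat.Base using (ℕ) renaming (_≤_ to _≤ℕ_)
open import Data.Product.Base using (Σ; ∃; ∃-syntax; _×_; _,_)
open import Data.Sum.Base using (_⊎_; inj₁; inj₂)
open import Data.Sum.Relation.Binary.Pointwise using (Pointwise)
open import Function.Base using (_∘_)
open import Function.Bundles using (_⇔_; _↔_; module Inverse)
open import Function.Definitions using (StrictlySurjective)
open import Relation.Binary.Construct.Closure.Equivalence using (EqClosure)
open import Relation.Binary.Construct.Closure.ReflexiveTransitive using (Star)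
import Relation.Binary.Construct.NonStrictToStrict as ToStrict
open import Relation.Binary.Core using (Rel)
open import Relation.Binary.Definitions using (Decidable; Irreflexive; Symmetric)
open import Relation.Binary.PropositionalEquality.Core using (_≡_; _≢_; ≢-sym)
open import Relation.Binary.Structures using (IsDecTotalOrder)
open import Relation.Nullary.Decidable.Core using (⌊_⌋; ¬?)
open import Relation.Nullary.Negation.Core using (¬_)
open import Relation.Unary using (Pred; _∈_; U)

private
  variable
    m n k : ℕ

------------------------------------------------------------------------
-- The real numbers

-- A Dedekind-complete ordered field (unique up to isomorphism) together with
-- its power function.  Equality is the setoid equality of the ring; the order
-- is decidable, as it is classically.
record RealNumbers (c ℓ : Level) : Set (lsuc (c ⊔ ℓ)) where
  infixr 8 _^_
  infix  4 _≤_
  field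
    commutativeRing : CommutativeRing c ℓ

  open CommutativeRing commutativeRing public

  field
    _≤_             : Rel Carrier ℓ
    isDecTotalOrder : IsDecTotalOrder _≈_ _≤_

  open IsDecTotalOrder isDecTotalOrder public
    using (_≤?_) renaming (_≟_ to _≈?_)
  open ToStrict _≈_ _≤_ public using (_<_)

  field
    1≉0      : ¬ 1# ≈ 0#
    inverse  : ∀ x → ¬ x ≈ 0# → ∃[ y ] x * y ≈ 1#
    +-monoʳ  : ∀ x {y z} → y ≤ z → x + y ≤ x + z
    *-nonneg : ∀ {x y} → 0# ≤ x → 0# ≤ y → 0# ≤ x * y

  _IsUpperBoundOf_ : Carrier → Pred Carrier ℓ → Set (c ⊔ ℓ)
  u IsUpperBoundOf P = ∀ x → x ∈ P → x ≤ u

  field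
    supremum : (P : Pred Carrier ℓ) → ∃ P → ∃ (_IsUpperBoundOf P) →
               ∃[ s ] s IsUpperBoundOf P × (∀ u → u IsUpperBoundOf P → s ≤ u)

  -- The laws below determine x ^ α for every x > 0 and every α: for x > 1 they
  -- make α ↦ x ^ α a strictly increasing homomorphism from (ℝ, +) to (ℝ⁺, *)
  -- with x ^ 1 = x, and multiplicativity in the base then gives x < 1.
  -- Nothing is said about x ^ α for x ≤ 0, and no use is made of it.
  field
    _^_           : Carrier → Carrier → Carrier
    ^-cong        : ∀ {x y α β} → x ≈ y → α ≈ β → x ^ α ≈ y ^ β
    ^-identityʳ   : ∀ {x} → 0# < x → x ^ 1# ≈ x
    ^-distribˡ-+  : ∀ {x} α β → 0# < x → x ^ (α + β) ≈ x ^ α * x ^ β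
    ^-distribʳ-*  : ∀ {x y} α → 0# < x → 0# < y → (x * y) ^ α ≈ x ^ α * y ^ α
    ^-expansive   : ∀ {x α} → 1# < x → 0# < α → 1# < x ^ α

------------------------------------------------------------------------
-- Graphs

record Graph (n : ℕ) : Set₁ where
  infix 4 _~_
  field
    _~_    : Rel (Fin n) 0ℓ
    _~?_   : Decidable _~_
    sym    : Symmetric _~_
    irrefl : Irreflexive _≡_ _~_

open Graph

Isolated : Graph n → Fin n → Set
Isolated G v = ∀ w → ¬ G ._~_ v w

complete : ∀ n → Graph n
complete n ._~_         = _≢_
complete n ._~?_ i j    = ¬? (i ≟ j)
complete n .sym         = ≢-sym
complete n .irrefl eq ne = ne eq

Connected : Graph n → Set
Connected G = ∀ v w → Star (G ._~_) v w

-- No closed walk x, y, z, …, x whose (at least three) vertices are distinct.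
Acyclic : Graph n → Set
Acyclic G = ∀ x y z zs → Unique (x ∷ y ∷ z ∷ zs) →
            ¬ Linked (G ._~_) (x ∷ y ∷ z ∷ zs ∷ʳ x)

record IsTree (G : Graph n) : Set where
  field
    nonempty  : 1 ≤ℕ n
    connected : Connected G
    acyclic   : Acyclic G

-- Adjacency in the disjoint union of a finite family of graphs.
data ⨆ {size : Fin k → ℕ} (H : ∀ j → Graph (size j)) :
       Rel (Σ (Fin k) (Fin ∘ size)) 0ℓ where
  within : ∀ {j v w} → H j ._~_ v w → ⨆ H (j , v) (j , w)

_IsDisjointUnionOf_ : {size : Fin k → ℕ} →
                      Graph n → (∀ j → Graph (size j)) → Set
_IsDisjointUnionOf_ {k} {n} {size} G H =
  Σ (Σ (Fin k) (Fin ∘ size) ↔ Fin n) λ f →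
    ∀ a b → G ._~_ (Inverse.to f a) (Inverse.to f b) ⇔ ⨆ H a b

-- A disjoint union of copies of K₂, where isolated vertices (copies of K₁) are
-- disregarded.  They have to be: K₂ ⊔ K₁ becomes the path P₃ (and an isolated
-- vertex) when an edge is attached to a vertex of K₂, and the powers
-- preserving positivity change from [0,∞) to [1,∞).
IsUnionOfK₂s : Graph n → Set
IsUnionOfK₂s G =
  ∃[ k ] Σ (Fin k → ℕ) λ size →
    (∀ j → size j ≡ 1 ⊎ size j ≡ 2) ×
    (G IsDisjointUnionOf λ j → complete (size j))

-- Finitely many trees T j to be attached to nodes of a graph on Fin m, the
-- vertex root j of T j being identified with node j.  Any number of trees
-- (also none) may share a node.
record TreesToAttach (m : ℕ) : Set₁ where
  field
    #trees : ℕ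
    size   : Fin #trees → ℕ
    T      : ∀ j → Graph (size j)
    isTree : ∀ j → IsTree (T j)
    root   : ∀ j → Fin (size j)
    node   : Fin #trees → Fin m

  Vertex : Set
  Vertex = Fin m ⊎ Σ (Fin #trees) (Fin ∘ size)

  data Identified : Rel Vertex 0ℓ where
    identified : ∀ j → Identified (inj₁ (node j)) (inj₂ (j , root j))

-- G is G′ with trees attached: `glue` presents G as the quotient of the
-- disjoint union of G′ and all the trees by the identifications above.
record TreeAttachment (G′ : Graph m) (G : Graph n) : Set₁ where
  field
    trees : TreesToAttach m

  open TreesToAttach trees public

  field
    glue            : Vertex → Fin n
    glue-surjective : StrictlySurjective _≡_ glue
    glue-kernel     : ∀ a b → glue a ≡ glue b ⇔ EqClosure Identified a b
    glue-adjacent   : ∀ v w → G ._~_ v w ⇔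
                      (∃[ a ] ∃[ b ] glue a ≡ v × glue b ≡ w ×
                                     Pointwise (G′ ._~_) (⨆ T) a b)

------------------------------------------------------------------------
-- Entrywise powers preserving positivity

module EntrywisePowers {c ℓ} (ℝ : RealNumbers c ℓ) where

  open RealNumbers ℝ hiding (sym)
  open import Algebra.Properties.CommutativeMonoid.Sum +-commutativeMonoid
    using (sum)

  Matrix : ℕ → Set c
  Matrix n = Fin n → Fin n → Carrier

  PositiveSemidefinite : Matrix n → Set (c ⊔ ℓ)
  PositiveSemidefinite {n} A =
    ∀ (x : Fin n → Carrier) → 0# ≤ sum (λ i → sum (λ j → x i * A i j * x j))

  record 𝓟 {i} (G : Graph n) (I : Pred Carrier i) (A : Matrix n) :
           Set (c ⊔ ℓ ⊔ i) where
    field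
      symmetric : ∀ i j → A i j ≈ A j i
      positive  : PositiveSemidefinite A
      entries   : ∀ i j → A i j ∈ I
      zeros     : ∀ i j → i ≢ j → ¬ G ._~_ i j → A i j ≈ 0#

  [0,∞⟩ : Pred Carrier ℓ
  [0,∞⟩ x = 0# ≤ x

  ∣_∣ : Carrier → Carrier
  ∣ x ∣ = if ⌊ 0# ≤? x ⌋ then x else - x

  sgn : Carrier → Carrier
  sgn x = if ⌊ x ≈? 0# ⌋ then 0# else if ⌊ 0# ≤? x ⌋ then 1# else - 1#

  pow ψ φ : Carrier → Carrier → Carrier
  pow α x = if ⌊ x ≈? 0# ⌋ then 0# else x ^ α
  ψ   α x = if ⌊ x ≈? 0# ⌋ then 0# else sgn x * ∣ x ∣ ^ α
  φ   α x = if ⌊ x ≈? 0# ⌋ then 0# else ∣ x ∣ ^ α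

  infix 9 _[_]
  _[_] : (Carrier → Carrier) → Matrix n → Matrix n
  (f [ A ]) i j = f (A i j)

  𝓗 𝓗ψ 𝓗φ : Graph n → Pred Carrier (c ⊔ ℓ)
  𝓗  G α = ∀ A → 𝓟 G [0,∞⟩ A → 𝓟 G U (pow α [ A ])
  𝓗ψ G α = ∀ A → 𝓟 G U A → 𝓟 G U (ψ α [ A ])
  𝓗φ G α = ∀ A → 𝓟 G U A → 𝓟 G U (φ α [ A ])

  IsMinimum : Pred Carrier (c ⊔ ℓ) → Carrier → Set (c ⊔ ℓ)
  IsMinimum S α = α ∈ S × (∀ β → β ∈ S → α ≤ β)

  -- "The critical exponent exists and equals α."
  IsCE-H IsCE-Hψ IsCE-Hφ : Graph n → Carrier → Set (c ⊔ ℓ)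
  IsCE-H  G = IsMinimum λ α → ∀ β → α ≤ β → β ∈ 𝓗  G
  IsCE-Hψ G = IsMinimum λ α → ∀ β → α ≤ β → β ∈ 𝓗ψ G
  IsCE-Hφ G = IsMinimum λ α → ∀ β → α ≤ β → β ∈ 𝓗φ G

{-# OPTIONS --safe #-}
-- Let v be a leaf with neighbour p.  A matrix A in 𝓟 G with A v v > 0 is positive
-- semidefinite iff the Schur complement B of that entry is; B lives on the graph
-- without v and differs there from A only in B p p = A p p - (A v p)² / A v v.  For
-- α ≥ 1 superadditivity of x ↦ x ^ α on [0,∞) shows that f [ A ] is at least f [ B ]
-- plus a positive semidefinite matrix supported on {v , p}, where f is any of the
-- three power functions.  So attached trees can be removed leaf by leaf.  Conversely
-- α ≥ 1 is forced by any vertex with two neighbours, and a graph without such a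
-- vertex is a disjoint union of copies of K₂ and K₁.
module Submission where

open import Defs
open import Level using (_⊔_; 0ℓ)
open import Data.Bool.Properties using () renaming (_≟_ to _≟ᵇ_)
open import Data.Empty using (⊥-elim)
open import Data.Fin.Base using (Fin; zero; suc) renaming (_<_ to _<ᶠ_)
open import Data.Fin.Patterns using (0F; 1F; 2F)
open import Data.Fin.Properties using (_≟_; any?; all?; <-cmp; <-asym) renaming (_<?_ to _<ᶠ?_)
open import Data.List.Base using (List; []; _∷_; _∷ʳ_; filter; allFin; lookup; length)
import Data.List.Membership.DecPropositional as DecMembership
open import Data.List.Membership.Propositional using () renaming (_∈_ to _∈ᴸ_; _∉_ to _∉ᴸ_)
open import Data.List.Membership.Propositional.Properties using (∈-allFin; ∈-filter⁺; ∈-filter⁻; ∈-lookup)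
open import Data.List.Relation.Binary.Subset.Propositional using () renaming (_⊆_ to _⊆ᴸ_)
open import Data.List.Relation.Unary.All as All using (All; []; _∷_)
open import Data.List.Relation.Unary.All.Properties using (∷ʳ⁺)
open import Data.List.Relation.Unary.AllPairs using ([]; _∷_)
open import Data.List.Relation.Unary.Any using (index; here; there)
open import Data.List.Relation.Unary.Any.Properties using (lookup-index)
open import Data.List.Relation.Unary.Linked using (Linked; [-]; _∷_)
open import Data.List.Relation.Unary.Unique.Propositional using (Unique)
open import Data.List.Relation.Unary.Unique.Propositional.Properties using (allFin⁺; filter⁺; ++⁺)
open import Data.Nat.Base using (ℕ; s≤s) renaming (_≤_ to _≤ℕ_)
open import Data.Product.Base using (Σ; _×_; _,_; proj₁; proj₂; ∃-syntax)
open import Data.Sum.Base using (_⊎_; inj₁; inj₂; [_,_]′)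
open import Data.Sum.Relation.Binary.Pointwise using (inj₁; inj₂)
open import Data.Unit.Base using (tt)
open import Function.Base using (_∘_; id; _on_)
open import Function.Bundles using (_⇔_; mk⇔; mk⤖; module Equivalence)
open import Function.Consequences.Propositional using (strictlySurjective⇒surjective)
open import Function.Definitions using (Injective; StrictlySurjective)
open import Function.Properties.Bijection using (⤖⇒↔)
open import Relation.Binary.Construct.Closure.Equivalence using (gfold; return)
open import Relation.Binary.Construct.Closure.ReflexiveTransitive using (Star; ε; _◅_)
import Relation.Binary.Construct.NonStrictToStrict as ToStrict
open import Relation.Binary.Definitions using (tri<; tri≈; tri>)
open import Relation.Binary.PropositionalEquality as ≡ using (_≡_; _≢_)
open import Relation.Binary.Structures using (IsDecTotalOrder)
open import Relation.Nullary.Decidable using (Dec; yes; no; does; _×-dec_; _→-dec_; ¬?; decidable-stable)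
open import Relation.Nullary.Negation using (¬_; contradiction)
open import Relation.Unary using (Pred; _∈_; _∉_; U; _⊆_; _≐_)
import Algebra.Properties.CommutativeMonoid.Sum
import Algebra.Properties.Ring
import Algebra.Solver.Ring.NaturalCoefficients.Default
import Relation.Binary.Reasoning.Setoid

-- Vertices with two neighbours

-- Put c = A v v, b = A v p, d = 1 / c and e = A p p - b² d. Since f 0 = 0, the difference f [ A ] -
-- f [ B ] has on {v , p} the diagonal f c, f (e + b² d) - f e and the off-diagonal entry f b. It is
-- positive semidefinite once f(b)² f(d) ≤ f (e + b² d) - f e. By multiplicativity the left side is
-- the power of b² d, so superadditivity at e and b² d is exactly the inequality required. The sign
-- of f b disappears in f(b)², and all other arguments are nonnegative: this is why one argument
-- serves all three functions. Deleting a vertex would change the index type of the matrices. They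
-- keep it instead, and the induction runs over the set that supports them (`PreservesOn`). Trees
-- arrive as connected acyclic graphs and attachment as a quotient by an equivalence closure.
-- Neither exhibits a leaf, so the trees are first turned into orders in which every new vertex has
-- a single earlier neighbour (`Grown`), and the quotient into normal forms (`normalise`).

lookup-injective : ∀ {a} {A : Set a} {xs : List A} → Unique xs →
                   ∀ {i j} → lookup xs i ≡ lookup xs j → i ≡ j
lookup-injective {xs = _ ∷ _} _          {zero}  {zero}  _  = ≡.refl
lookup-injective {xs = _ ∷ _} (x∉xs ∷ _) {zero}  {suc j} eq = contradiction eq (All.lookup x∉xs (∈-lookup j))
lookup-injective {xs = _ ∷ _} (x∉xs ∷ _) {suc i} {zero}  eq = contradiction (≡.sym eq) (All.lookup x∉xs (∈-lookup i))
lookup-injective {xs = _ ∷ _} (_ ∷ xs!)  {suc i} {suc j} eq = ≡.cong suc (lookup-injective xs! eq)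

module _ {n : ℕ} (G : Graph n) where
  open Graph G renaming (sym to ~-sym)

  -- The path on three vertices as a subgraph, not necessarily induced: `a` and `b` may be adjacent,
  -- since a matrix may vanish on an edge.
  Cherry : Set
  Cherry = ∃[ v ] ∃[ a ] ∃[ b ] a ≢ b × v ~ a × v ~ b

  cherry? : Dec Cherry
  cherry? = any? λ v → any? λ a → any? λ b → ¬? (a ≟ b) ×-dec v ~? a ×-dec v ~? b

  AtMostOneNeighbour : Set
  AtMostOneNeighbour = ∀ {v a b} → v ~ a → v ~ b → a ≡ b

  ¬cherry⇒atMostOneNeighbour : ¬ Cherry → AtMostOneNeighbour
  ¬cherry⇒atMostOneNeighbour ¬c {v} {a} {b} v~a v~b =
    decidable-stable (a ≟ b) λ a≢b → ¬c (v , a , b , a≢b , v~a , v~b)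

  module _ (amon : AtMostOneNeighbour) where

    -- With a single neighbour available at each vertex, a walk can only go back and forth along one
    -- edge.
    reachable⇒near : ∀ {v w} → Star _~_ v w → w ≡ v ⊎ v ~ w
    reachable⇒near ε = inj₁ ≡.refl
    reachable⇒near (v~u ◅ u⋯w) with reachable⇒near u⋯w
    ... | inj₁ ≡.refl = inj₂ v~u
    ... | inj₂ u~w    = inj₁ (amon u~w (~-sym v~u))

    -- Every component is represented by its smaller vertex.
    Least : Fin n → Set
    Least v = ∀ w → v ~ w → v <ᶠ w

    least? : ∀ v → Dec (Least v)
    least? v = all? λ w → (v ~? w) →-dec (v <ᶠ? w)

    least-≁ : ∀ {v w} → Least v → Least w → ¬ v ~ w
    least-≁ lv lw v~w = <-asym (lv _ v~w) (lw _ (~-sym v~w))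

    HasNeighbour : Fin n → Set
    HasNeighbour v = ∃[ w ] v ~ w

    -- The decision is an argument, so that matching on it makes the size of a component and its
    -- `member` function compute together.
    orderOf : ∀ {v} → Dec (HasNeighbour v) → ℕ
    orderOf (yes _) = 2
    orderOf (no _)  = 1

    member : ∀ {v} (d : Dec (HasNeighbour v)) → Fin (orderOf d) → Fin n
    member {v} (yes _)       zero       = v
    member     (yes (w , _)) (suc zero) = w
    member {v} (no _)        zero       = v

    member-view : ∀ {v} (d : Dec (HasNeighbour v)) x →
                  member d x ≡ v ⊎ v ~ member d x
    member-view (yes _)         zero       = inj₁ ≡.refl
    member-view (yes (_ , v~w)) (suc zero) = inj₂ v~w
    member-view (no _)          zero       = inj₁ ≡.refl

    member-self : ∀ {v} (d : Dec (HasNeighbour v)) → ∃[ x ] member d x ≡ v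
    member-self (yes _) = zero , ≡.refl
    member-self (no _)  = zero , ≡.refl

    member-neighbour : ∀ {v w} (d : Dec (HasNeighbour v)) → v ~ w →
                       ∃[ x ] member d x ≡ w
    member-neighbour (yes (_ , v~u)) v~w = suc zero , amon v~u v~w
    member-neighbour (no ¬nb)        v~w = contradiction (_ , v~w) ¬nb

    member-injective : ∀ {v} (d : Dec (HasNeighbour v)) {x y} →
                       member d x ≡ member d y → x ≡ y
    member-injective (yes _)         {zero}     {zero}     _  = ≡.refl
    member-injective (yes (_ , v~w)) {zero}     {suc zero} eq = ⊥-elim (irrefl eq v~w)
    member-injective (yes (_ , v~w)) {suc zero} {zero}     eq = ⊥-elim (irrefl (≡.sym eq) v~w)
    member-injective (yes _)         {suc zero} {suc zero} _  = ≡.refl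
    member-injective (no _)          {zero}     {zero}     _  = ≡.refl

    member-adjacent : ∀ {v} (d : Dec (HasNeighbour v)) {x y} → x ≢ y →
                      member d x ~ member d y
    member-adjacent (yes _)         {zero}     {zero}     ne = contradiction ≡.refl ne
    member-adjacent (yes (_ , v~w)) {zero}     {suc zero} _  = v~w
    member-adjacent (yes (_ , v~w)) {suc zero} {zero}     _  = ~-sym v~w
    member-adjacent (yes _)         {suc zero} {suc zero} ne = contradiction ≡.refl ne
    member-adjacent (no _)          {zero}     {zero}     ne = contradiction ≡.refl ne

    -- Unless the claim is immediate, the hypotheses make v and w adjacent, which is impossible for
    -- two least vertices, or give them a common neighbour, which then has only one neighbour.
    -- Allowing a ≡ b as well as a ~ b serves both the injectivity of `vertex` and the fact that
    -- edges stay inside one component.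
    same-component : ∀ {v w a b} → Least v → Least w →
                     a ≡ v ⊎ v ~ a → b ≡ w ⊎ w ~ b → a ≡ b ⊎ a ~ b → v ≡ w
    same-component lv lw (inj₁ ≡.refl) (inj₁ ≡.refl) (inj₁ a≡b)    = a≡b
    same-component lv lw (inj₁ ≡.refl) (inj₂ w~b)    (inj₁ ≡.refl) = ⊥-elim (least-≁ lw lv w~b)
    same-component lv lw (inj₂ v~a)    (inj₁ ≡.refl) (inj₁ ≡.refl) = ⊥-elim (least-≁ lv lw v~a)
    same-component lv lw (inj₂ v~a)    (inj₂ w~b)    (inj₁ ≡.refl) = amon (~-sym v~a) (~-sym w~b)
    same-component lv lw (inj₁ ≡.refl) (inj₁ ≡.refl) (inj₂ a~b)    = ⊥-elim (least-≁ lv lw a~b)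
    same-component lv lw (inj₁ ≡.refl) (inj₂ w~b)    (inj₂ a~b)    = amon (~-sym a~b) (~-sym w~b)
    same-component lv lw (inj₂ v~a)    (inj₁ ≡.refl) (inj₂ a~b)    = amon (~-sym v~a) a~b
    same-component lv lw (inj₂ v~a)    (inj₂ w~b)    (inj₂ a~b)
      with ≡.refl ← amon (~-sym v~a) a~b = ⊥-elim (least-≁ lw lv w~b)

    private
      leasts : List (Fin n)
      leasts = filter least? (allFin n)

      least : Fin (length leasts) → Fin n
      least = lookup leasts

      least-Least : ∀ j → Least (least j)
      least-Least j = proj₂ (∈-filter⁻ least? {xs = allFin n} (∈-lookup j))

      least-surjective : ∀ {v} → Least v → ∃[ j ] least j ≡ v
      least-surjective lv =
        let v∈ = ∈-filter⁺ least? (∈-allFin _) lv in index v∈ , ≡.sym (lookup-index v∈)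

      least-injective : ∀ {i j} → least i ≡ least j → i ≡ j
      least-injective = lookup-injective (filter⁺ least? (allFin⁺ n))

      neighbour? : ∀ j → Dec (HasNeighbour (least j))
      neighbour? j = any? (least j ~?_)

      size : Fin (length leasts) → ℕ
      size j = orderOf (neighbour? j)

      vertex : Σ (Fin (length leasts)) (Fin ∘ size) → Fin n
      vertex (j , x) = member (neighbour? j) x

      vertex-sameComponent : ∀ i x j y →
        vertex (i , x) ≡ vertex (j , y) ⊎ vertex (i , x) ~ vertex (j , y) → i ≡ j
      vertex-sameComponent i x j y = least-injective ∘ same-component (least-Least i) (least-Least j)
        (member-view (neighbour? i) x) (member-view (neighbour? j) y)

      vertex-injective : Injective _≡_ _≡_ vertex
      vertex-injective {i , x} {j , y} eq with ≡.refl ← vertex-sameComponent i x j y (inj₁ eq) =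
        ≡.cong (i ,_) (member-injective (neighbour? i) eq)

      vertex-surjective : StrictlySurjective _≡_ vertex
      vertex-surjective u = go (any? (u ~?_))
        where
        at-least : Least u → ∃[ a ] vertex a ≡ u
        at-least lu with j , ≡.refl ← least-surjective lu =
          let x , eq = member-self (neighbour? j) in (j , x) , eq

        go : Dec (HasNeighbour u) → ∃[ a ] vertex a ≡ u
        -- An isolated vertex is least vacuously, hence represents its own component.
        go (no ¬nb) = at-least λ w u~w → contradiction (w , u~w) ¬nb
        go (yes (w , u~w)) with <-cmp u w
        ... | tri< u<w _ _ = at-least λ w′ u~w′ → ≡.subst (u <ᶠ_) (amon u~w u~w′) u<w
        ... | tri≈ _ u≡w _ = ⊥-elim (irrefl u≡w u~w)
        ... | tri> _ _ w<u
          with j , ≡.refl ← least-surjective {w} (λ u′ w~u′ → ≡.subst (w <ᶠ_) (amon (~-sym u~w) w~u′) w<u) =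
          let x , eq = member-neighbour (neighbour? j) (~-sym u~w) in (j , x) , eq

      vertex-adjacent : ∀ a b → vertex a ~ vertex b ⇔ ⨆ (complete ∘ size) a b
      vertex-adjacent (i , x) (j , y) = mk⇔ to from
        where
        to : vertex (i , x) ~ vertex (j , y) → ⨆ (complete ∘ size) (i , x) (j , y)
        to a~b with ≡.refl ← vertex-sameComponent i x j y (inj₂ a~b) =
          within λ { ≡.refl → irrefl ≡.refl a~b }

        from : ⨆ (complete ∘ size) (i , x) (j , y) → vertex (i , x) ~ vertex (j , y)
        from (within x≢y) = member-adjacent (neighbour? i) x≢y

      order≡1⊎2 : ∀ {v} (d : Dec (HasNeighbour v)) → orderOf d ≡ 1 ⊎ orderOf d ≡ 2
      order≡1⊎2 (yes _) = inj₂ ≡.refl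
      order≡1⊎2 (no _)  = inj₁ ≡.refl

    atMostOneNeighbour⇒isUnionOfK₂s : IsUnionOfK₂s G
    atMostOneNeighbour⇒isUnionOfK₂s =
      length leasts , size , (λ j → order≡1⊎2 (neighbour? j)) ,
      ⤖⇒↔ (mk⤖ (vertex-injective , strictlySurjective⇒surjective vertex-surjective)) ,
      vertex-adjacent

  ¬isUnionOfK₂s⇒cherry : ¬ IsUnionOfK₂s G → Cherry
  ¬isUnionOfK₂s⇒cherry ¬K₂s = decidable-stable cherry? λ ¬c →
    ¬K₂s (atMostOneNeighbour⇒isUnionOfK₂s (¬cherry⇒atMostOneNeighbour ¬c))

-- Without a cherry, reachability shrinks to adjacency, and vertex 0 would have both 1 and 2 as
-- neighbours.
connected⇒cherry : ∀ {n} (G : Graph n) → 3 ≤ℕ n → Connected G → Cherry G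
connected⇒cherry G (s≤s (s≤s (s≤s _))) conn =
  decidable-stable (cherry? G) λ ¬c → go (¬cherry⇒atMostOneNeighbour G ¬c)
  where
  go : ¬ AtMostOneNeighbour G
  go amon with reachable⇒near G amon (conn 0F 1F) | reachable⇒near G amon (conn 0F 2F)
  ... | inj₂ 0~1 | inj₂ 0~2 with () ← amon 0~1 0~2

-- Trees

module _ {n : ℕ} (G : Graph n) where
  open Graph G renaming (sym to ~-sym)
  open DecMembership (_≟_ {n}) using (_∈?_)

  data Path : Fin n → Fin n → List (Fin n) → Set where
    [-] : ∀ {x} → Path x x (x ∷ [])
    _∷_ : ∀ {x y z xs} → x ~ y → Path y z xs → Path x z (x ∷ xs)

  Path-∷ʳ : ∀ {x y z xs} → Path x y xs → y ~ z → Path x z (xs ∷ʳ z)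
  Path-∷ʳ [-]        y~z = y~z ∷ [-]
  Path-∷ʳ (x~u ∷ us) y~z = x~u ∷ Path-∷ʳ us y~z

  Path⇒Linked : ∀ {x y xs} → Path x y xs → Linked _~_ xs
  Path⇒Linked [-]              = [-]
  Path⇒Linked (x~y ∷ [-])      = x~y ∷ [-]
  Path⇒Linked (x~y ∷ y~z ∷ us) = x~y ∷ Path⇒Linked (y~z ∷ us)

  SimplePathWithin : List (Fin n) → Fin n → Fin n → Set
  SimplePathWithin S x y = ∃[ xs ] Path x y xs × Unique xs × All (_∈ᴸ S) xs

  -- An elimination order: read from the head, each vertex is a leaf of the graph induced on itself
  -- and the vertices after it, until only the root is left.
  data Grown (r : Fin n) : List (Fin n) → Set where
    single : Grown r (r ∷ [])
    attach : ∀ {S v p} → Grown r S → v ∉ᴸ S → p ∈ᴸ S → v ~ p →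
             (∀ {q} → q ∈ᴸ S → v ~ q → q ≡ p) → Grown r (v ∷ S)

  root∈grown : ∀ {r S} → Grown r S → r ∈ᴸ S
  root∈grown single             = here ≡.refl
  root∈grown (attach g _ _ _ _) = there (root∈grown g)

  -- Paths remain simple because the newest vertex lies outside the set through which the older path
  -- runs. They supply the long arc of the cycle in `grown-uniqueNeighbour`.
  grown-connected : ∀ {r S x y} → Grown r S → x ∈ᴸ S → y ∈ᴸ S → SimplePathWithin S x y
  grown-connected single (here ≡.refl) (here ≡.refl) = _ , [-] , [] ∷ [] , here ≡.refl ∷ []
  grown-connected (attach g v∉S p∈S v~p _) (here ≡.refl) (here ≡.refl) =
    _ , [-] , [] ∷ [] , here ≡.refl ∷ []
  grown-connected (attach g v∉S p∈S v~p _) (here ≡.refl) (there y∈S) =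
    let xs , path , xs! , xs⊆S = grown-connected g p∈S y∈S in
    _ , v~p ∷ path , All.map (λ { x∈S ≡.refl → v∉S x∈S }) xs⊆S ∷ xs! ,
    here ≡.refl ∷ All.map there xs⊆S
  grown-connected (attach g v∉S p∈S v~p _) (there x∈S) (here ≡.refl) =
    let xs , path , xs! , xs⊆S = grown-connected g x∈S p∈S in
    _ , Path-∷ʳ path (~-sym v~p) ,
    ++⁺ xs! ([] ∷ []) (λ { (v∈xs , here ≡.refl) → v∉S (All.lookup xs⊆S v∈xs) }) ,
    ∷ʳ⁺ (All.map there xs⊆S) (here ≡.refl)
  grown-connected (attach g _ _ _ _) (there x∈S) (there y∈S) =
    let xs , path , xs! , xs⊆S = grown-connected g x∈S y∈S in
    xs , path , xs! , All.map there xs⊆S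

  module _ (tree : IsTree G) (r : Fin n) where
    open IsTree tree

    -- A second neighbour q would close the simple path from p to q inside S, through the outside
    -- vertex v, to a cycle.
    grown-uniqueNeighbour : ∀ {S v p q} → Grown r S → v ∉ᴸ S →
                            p ∈ᴸ S → v ~ p → q ∈ᴸ S → v ~ q → q ≡ p
    grown-uniqueNeighbour {S} {v} {p} {q} g v∉S p∈S v~p q∈S v~q =
      decidable-stable (q ≟ p) λ q≢p → closes q≢p (grown-connected g p∈S q∈S)
      where
      closes : q ≢ p → ¬ SimplePathWithin S p q
      closes q≢p (_ , [-] , _) = q≢p ≡.refl
      closes _ (_ ∷ xs , p~z ∷ path , xs! , xs⊆S) = go path p~z xs! xs⊆S
        where
        go : ∀ {z xs} → Path z q xs → p ~ z → Unique (p ∷ xs) → ¬ All (_∈ᴸ S) (p ∷ xs)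
        -- Both clauses have the same body; the match only exposes a third vertex z, as the shape of
        -- the cycle in `Acyclic` demands.
        go path@[-] p~z xs! xs⊆S = acyclic _ _ _ _
          (All.map (λ { x∈S ≡.refl → v∉S x∈S }) xs⊆S ∷ xs!)
          (v~p ∷ Path⇒Linked (p~z ∷ Path-∷ʳ path (~-sym v~q)))
        go path@(_ ∷ _) p~z xs! xs⊆S = acyclic _ _ _ _
          (All.map (λ { x∈S ≡.refl → v∉S x∈S }) xs⊆S ∷ xs!)
          (v~p ∷ Path⇒Linked (p~z ∷ Path-∷ʳ path (~-sym v~q)))

    -- Each vertex of the walk that is still missing can be attached to its predecessor, acyclicity
    -- ruling out a second neighbour.
    grow-along : ∀ {S v w} → Grown r S → v ∈ᴸ S → Star _~_ v w →
                 ∃[ S′ ] Grown r S′ × S ⊆ᴸ S′ × w ∈ᴸ S′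
    grow-along g v∈S ε = _ , g , id , v∈S
    grow-along {S} g v∈S (_◅_ {j = u} v~u u⋯w) with u ∈? S
    ... | yes u∈S = grow-along g u∈S u⋯w
    ... | no  u∉S =
      let S′ , g′ , S⊆S′ , w∈S′ = grow-along
            (attach g u∉S v∈S (~-sym v~u) (grown-uniqueNeighbour g u∉S v∈S (~-sym v~u)))
            (here ≡.refl) u⋯w
      in S′ , g′ , S⊆S′ ∘ there , w∈S′

    grow-to : ∀ ws → ∃[ S ] Grown r S × All (_∈ᴸ S) ws
    grow-to []       = _ , single , []
    grow-to (w ∷ ws) =
      let S  , g  , ws⊆S        = grow-to ws
          S′ , g′ , S⊆S′ , w∈S′ = grow-along g (root∈grown g) (connected r w)
      in S′ , g′ , w∈S′ ∷ All.map S⊆S′ ws⊆S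

    tree-grown : ∃[ S ] Grown r S × (∀ v → v ∈ᴸ S)
    tree-grown = let S , g , all = grow-to (allFin n) in
      S , g , λ v → All.lookup all (∈-allFin v)

-- Vertices and edges of a graph with trees glued to it

module Gluing {m n} {G′ : Graph m} {G : Graph n} (attachment : TreeAttachment G′ G) where
  open TreeAttachment attachment
  open Graph

  core : Fin m → Fin n
  core a = glue (inj₁ a)

  treeVertex : ∀ j → Fin (size j) → Fin n
  treeVertex j u = glue (inj₂ (j , u))

  -- The canonical representative of a class of glued vertices: a root moves to its node, all else
  -- stays. Being constant on the generating identifications, it is constant on their equivalence
  -- closure, so equality under `glue` becomes an equation between constructors.
  normalise : Vertex → Vertex
  normalise (inj₁ a)       = inj₁ a
  normalise (inj₂ (j , u)) with u ≟ root j
  ... | yes _ = inj₁ (node j)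
  ... | no _  = inj₂ (j , u)

  normalise-identified : ∀ {a b} → Identified a b → normalise a ≡ normalise b
  normalise-identified (identified j) with root j ≟ root j
  ... | yes _ = ≡.refl
  ... | no ne = contradiction ≡.refl ne

  glue⇒normalise : ∀ {a b} → glue a ≡ glue b → normalise a ≡ normalise b
  glue⇒normalise {a} {b} eq =
    gfold ≡.isEquivalence normalise normalise-identified (Equivalence.to (glue-kernel a b) eq)

  core-injective : Injective _≡_ _≡_ core
  core-injective eq with ≡.refl ← glue⇒normalise eq = ≡.refl

  treeVertex-root : ∀ j → core (node j) ≡ treeVertex j (root j)
  treeVertex-root j = Equivalence.from (glue-kernel _ _) (return (identified j))

  normalise-nonroot : ∀ {j u} → u ≢ root j → normalise (inj₂ (j , u)) ≡ inj₂ (j , u)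
  normalise-nonroot {j} {u} u≢r with u ≟ root j
  ... | yes u≡r = contradiction u≡r u≢r
  ... | no _    = ≡.refl

  normalise≡inj₂ : ∀ {x} b → normalise b ≡ inj₂ x → b ≡ inj₂ x
  normalise≡inj₂ (inj₂ (i , w)) eq with no _ ← w ≟ root i = eq

  -- A tree vertex other than the root is alone in its class.
  glue-nonroot : ∀ {j u b} → u ≢ root j → treeVertex j u ≡ glue b → b ≡ inj₂ (j , u)
  glue-nonroot {b = b} u≢r eq =
    normalise≡inj₂ b (≡.trans (≡.sym (glue⇒normalise eq)) (normalise-nonroot u≢r))

  core≡treeVertex⇒root : ∀ {a j u} → core a ≡ treeVertex j u → u ≡ root j
  core≡treeVertex⇒root {j = j} {u} eq = decidable-stable (u ≟ root j) λ u≢r →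
    contradiction (glue-nonroot u≢r (≡.sym eq)) λ ()

  treeVertex-distinct : ∀ {i j u w} → i ≢ j → treeVertex i u ≡ treeVertex j w → u ≡ root i
  treeVertex-distinct {i} {u = u} i≢j eq = decidable-stable (u ≟ root i) λ u≢r →
    i≢j (tree-index (glue-nonroot u≢r eq))
    where
    tree-index : ∀ {i j u w} → _≡_ {A = Vertex} (inj₂ (j , w)) (inj₂ (i , u)) → i ≡ j
    tree-index ≡.refl = ≡.refl

  treeVertex-injective : ∀ j → Injective _≡_ _≡_ (treeVertex j)
  treeVertex-injective j {u} {w} eq with u ≟ root j | w ≟ root j
  ... | no u≢r     | _          with ≡.refl ← glue-nonroot u≢r eq = ≡.refl
  ... | yes _      | no w≢r     with ≡.refl ← glue-nonroot w≢r (≡.sym eq) = ≡.refl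
  ... | yes ≡.refl | yes ≡.refl = ≡.refl

  core-adjacent⁺ : ∀ {a b} → G′ ._~_ a b → G ._~_ (core a) (core b)
  core-adjacent⁺ a~b = Equivalence.from (glue-adjacent _ _) (_ , _ , ≡.refl , ≡.refl , inj₁ a~b)

  core-adjacent⁻ : ∀ a b → G ._~_ (core a) (core b) → G′ ._~_ a b
  core-adjacent⁻ a b a~b with Equivalence.to (glue-adjacent _ _) a~b
  ... | _ , _ , eq₁ , eq₂ , inj₁ a′~b′
    with ≡.refl ← core-injective eq₁ | ≡.refl ← core-injective eq₂ = a′~b′
  -- A tree edge between two core vertices would have the root at both ends.
  ... | _ , _ , eq₁ , eq₂ , inj₂ (within {j} u~w) =
    contradiction u~w (T j .irrefl
      (≡.trans (core≡treeVertex⇒root (≡.sym eq₁)) (≡.sym (core≡treeVertex⇒root (≡.sym eq₂)))))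

  -- An edge of the glued graph comes from an edge between representatives, and here one end has
  -- only one representative, which lies in the tree.
  treeVertex-neighbour : ∀ {j u w} → u ≢ root j → G ._~_ (treeVertex j u) w →
                         ∃[ u′ ] T j ._~_ u u′ × w ≡ treeVertex j u′
  treeVertex-neighbour u≢r u~w with Equivalence.to (glue-adjacent _ _) u~w
  ... | _ , _ , eq , ≡.refl , adjacent with ≡.refl ← glue-nonroot u≢r (≡.sym eq) | inj₂ (within u~u′) ← adjacent =
    _ , u~u′ , ≡.refl

module _ {c ℓ} (ℝ : RealNumbers c ℓ) where
  open RealNumbers ℝ hiding (zero)
  open EntrywisePowers ℝ
  open IsDecTotalOrder isDecTotalOrder
    using (total; antisym; ≤-respˡ-≈; ≤-respʳ-≈)
    renaming (trans to ≤-trans; reflexive to ≤-reflexive; refl to ≤-refl)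
  open Algebra.Properties.Ring ring
  open Algebra.Properties.CommutativeMonoid.Sum +-commutativeMonoid
    using (sum; sum-cong-≋; sum-replicate-zero; ∑-distrib-+; ∑-comm)
  open Algebra.Solver.Ring.NaturalCoefficients.Default commutativeSemiring
    using (solve; _:=_; _:+_; _:*_; con)
  open Relation.Binary.Reasoning.Setoid setoid

  -- Ordered fields and powers

  ≰⇒≥ : ∀ {x y} → ¬ x ≤ y → y ≤ x
  ≰⇒≥ x≰y = proj₁ (ToStrict.≰⇒> _≈_ _≤_ sym ≤-reflexive total x≰y)

  ≤-stable : ∀ {x y} → ¬ ¬ x ≤ y → x ≤ y
  ≤-stable = decidable-stable (_ ≤? _)

  +-monoˡ : ∀ z {x y} → x ≤ y → x + z ≤ y + z
  +-monoˡ z x≤y = ≤-respˡ-≈ (+-comm z _) (≤-respʳ-≈ (+-comm z _) (+-monoʳ z x≤y))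

  +-mono : ∀ {x y u v} → x ≤ y → u ≤ v → x + u ≤ y + v
  +-mono {y = y} {u} x≤y u≤v = ≤-trans (+-monoˡ u x≤y) (+-monoʳ y u≤v)

  +-nonneg : ∀ {x y} → 0# ≤ x → 0# ≤ y → 0# ≤ x + y
  +-nonneg 0≤x 0≤y = ≤-respˡ-≈ (+-identityˡ 0#) (+-mono 0≤x 0≤y)

  ≤⇒difference : ∀ {x y} → x ≤ y → ∃[ d ] 0# ≤ d × y ≈ x + d
  ≤⇒difference {x} {y} x≤y = y - x ,
    ≤-respˡ-≈ (-‿inverseʳ x) (+-monoˡ (- x) x≤y) , (begin
    y              ≈⟨ +-identityʳ y ⟨
    y + 0#         ≈⟨ +-congˡ (-‿inverseˡ x) ⟨
    y + (- x + x)  ≈⟨ solve 3 (λ x y z → y :+ (z :+ x) := x :+ (y :+ z)) refl x y (- x) ⟩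
    x + (y - x)    ∎)

  ≤-+-nonneg : ∀ {x d} → 0# ≤ d → x ≤ x + d
  ≤-+-nonneg {x} 0≤d = ≤-respˡ-≈ (+-identityʳ x) (+-monoʳ x 0≤d)

  +-cancelʳ-≤ : ∀ z {x y} → x + z ≤ y + z → x ≤ y
  +-cancelʳ-≤ z {x} {y} le = ≤-respˡ-≈ (lemma x) (≤-respʳ-≈ (lemma y) (+-monoˡ (- z) le))
    where
    lemma : ∀ x → (x + z) + - z ≈ x
    lemma x = trans (+-assoc x z (- z)) (trans (+-congˡ (-‿inverseʳ z)) (+-identityʳ x))

  *-monoʳ-nonneg : ∀ {z x y} → 0# ≤ z → x ≤ y → z * x ≤ z * y
  *-monoʳ-nonneg {z} {x} {y} 0≤z x≤y with d , 0≤d , y≈ ← ≤⇒difference x≤y =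
    ≤-respʳ-≈ (sym (trans (*-congˡ y≈) (distribˡ z x d))) (≤-+-nonneg (*-nonneg 0≤z 0≤d))

  -‿nonneg : ∀ {x} → x ≤ 0# → 0# ≤ - x
  -‿nonneg {x} x≤0 = ≤-respˡ-≈ (-‿inverseʳ x) (≤-respʳ-≈ (+-identityˡ (- x)) (+-monoˡ (- x) x≤0))

  -x*-x≈x*x : ∀ x → - x * - x ≈ x * x
  -x*-x≈x*x x = begin
    - x * - x      ≈⟨ -‿distribˡ-* x (- x) ⟨
    - (x * - x)    ≈⟨ -‿cong (-‿distribʳ-* x x) ⟨
    - - (x * x)    ≈⟨ -‿involutive (x * x) ⟩
    x * x          ∎

  square-nonneg : ∀ x → 0# ≤ x * x
  square-nonneg x with total 0# x
  ... | inj₁ 0≤x = *-nonneg 0≤x 0≤x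
  ... | inj₂ x≤0 = ≤-respʳ-≈ (-x*-x≈x*x x) (*-nonneg (-‿nonneg x≤0) (-‿nonneg x≤0))

  0≤1 : 0# ≤ 1#
  0≤1 = ≤-respʳ-≈ (*-identityˡ 1#) (square-nonneg 1#)

  2# : Carrier
  2# = 1# + 1#

  0≤2 : 0# ≤ 2#
  0≤2 = +-nonneg 0≤1 0≤1

  1<2 : 1# < 2#
  1<2 = ≤-+-nonneg 0≤1 , λ 1≈2 → 1≉0 (+-identityʳ-unique 1# 1# (sym 1≈2))

  0<1 : 0# < 1#
  0<1 = 0≤1 , λ 0≈1 → 1≉0 (sym 0≈1)

  <-≤-trans : ∀ {x y z} → x < y → y ≤ z → x < z
  <-≤-trans = ToStrict.<-≤-trans _≈_ _≤_ sym ≤-trans antisym ≤-respʳ-≈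

  <⇒≱ : ∀ {x y} → x < y → ¬ y ≤ x
  <⇒≱ = ToStrict.<⇒≱ _≈_ _≤_ antisym

  0<2 : 0# < 2#
  0<2 = <-≤-trans 0<1 (proj₁ 1<2)

  x≉0∧y≉0⇒x*y≉0 : ∀ {x y} → ¬ x ≈ 0# → ¬ y ≈ 0# → ¬ x * y ≈ 0#
  x≉0∧y≉0⇒x*y≉0 {x} {y} x≉0 y≉0 xy≈0 with x⁻¹ , xx⁻¹≈1 ← inverse x x≉0 = y≉0 (begin
    y                ≈⟨ *-identityˡ y ⟨
    1# * y           ≈⟨ *-congʳ xx⁻¹≈1 ⟨
    (x * x⁻¹) * y    ≈⟨ solve 3 (λ x z y → (x :* z) :* y := z :* (x :* y)) refl x x⁻¹ y ⟩
    x⁻¹ * (x * y)    ≈⟨ *-congˡ xy≈0 ⟩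
    x⁻¹ * 0#         ≈⟨ zeroʳ x⁻¹ ⟩
    0#               ∎)

  *-pos : ∀ {x y} → 0# < x → 0# < y → 0# < x * y
  *-pos (0≤x , x≉0) (0≤y , y≉0) = *-nonneg 0≤x 0≤y ,
    λ 0≈xy → x≉0∧y≉0⇒x*y≉0 (λ x≈0 → x≉0 (sym x≈0)) (λ y≈0 → y≉0 (sym y≈0)) (sym 0≈xy)

  inverse-nonneg : ∀ {x y} → 0# ≤ x → x * y ≈ 1# → 0# ≤ y
  inverse-nonneg {x} {y} 0≤x xy≈1 = ≤-respʳ-≈ (begin
    x * (y * y)    ≈⟨ *-assoc x y y ⟨
    x * y * y      ≈⟨ *-congʳ xy≈1 ⟩
    1# * y         ≈⟨ *-identityˡ y ⟩
    y              ∎) (*-nonneg 0≤x (square-nonneg y))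

  -- From x ^ 0 * x ^ 1 = x ^ 1 by cancelling x.
  ^-zeroʳ : ∀ {x} → 0# < x → x ^ 0# ≈ 1#
  ^-zeroʳ {x} 0<x@(_ , 0≉x) with x⁻¹ , xx⁻¹≈1 ← inverse x (λ x≈0 → 0≉x (sym x≈0)) = begin
    x ^ 0#                    ≈⟨ *-identityʳ _ ⟨
    x ^ 0# * 1#               ≈⟨ *-congˡ xx⁻¹≈1 ⟨
    x ^ 0# * (x * x⁻¹)        ≈⟨ *-assoc _ _ _ ⟨
    x ^ 0# * x * x⁻¹          ≈⟨ *-congʳ (*-congˡ (^-identityʳ 0<x)) ⟨
    x ^ 0# * x ^ 1# * x⁻¹     ≈⟨ *-congʳ (^-distribˡ-+ 0# 1# 0<x) ⟨
    x ^ (0# + 1#) * x⁻¹       ≈⟨ *-congʳ (^-cong refl (+-identityˡ 1#)) ⟩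
    x ^ 1# * x⁻¹              ≈⟨ *-congʳ (^-identityʳ 0<x) ⟩
    x * x⁻¹                   ≈⟨ xx⁻¹≈1 ⟩
    1#                        ∎

  ^-≉0 : ∀ {x} α → 0# < x → ¬ x ^ α ≈ 0#
  ^-≉0 {x} α 0<x x^α≈0 = 1≉0 (begin
    1#                  ≈⟨ ^-zeroʳ 0<x ⟨
    x ^ 0#              ≈⟨ ^-cong refl (-‿inverseʳ α) ⟨
    x ^ (α + - α)       ≈⟨ ^-distribˡ-+ α (- α) 0<x ⟩
    x ^ α * x ^ (- α)   ≈⟨ *-congʳ x^α≈0 ⟩
    0# * x ^ (- α)      ≈⟨ zeroˡ _ ⟩
    0#                  ∎)

  -- Positivity is not among the laws of the power, but x ^ α is the square of x ^ (α / 2).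
  ^-pos : ∀ {x} α → 0# < x → 0# < x ^ α
  ^-pos {x} α 0<x = ≤-respʳ-≈ halves (square-nonneg (x ^ (α * ½))) , λ 0≈ → ^-≉0 α 0<x (sym 0≈)
    where
    2⁻¹ : ∃[ y ] 2# * y ≈ 1#
    2⁻¹ = inverse 2# (λ 2≈0 → proj₂ 0<2 (sym 2≈0))
    ½ = proj₁ 2⁻¹
    halves : x ^ (α * ½) * x ^ (α * ½) ≈ x ^ α
    halves = begin
      x ^ (α * ½) * x ^ (α * ½)   ≈⟨ ^-distribˡ-+ _ _ 0<x ⟨
      x ^ (α * ½ + α * ½)         ≈⟨ ^-cong refl (solve 2 (λ a h → a :* h :+ a :* h := a :* ((con 1 :+ con 1) :* h)) refl α ½) ⟩
      x ^ (α * ((1# + 1#) * ½))   ≈⟨ ^-cong refl (trans (*-congˡ (proj₂ 2⁻¹)) (*-identityʳ α)) ⟩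
      x ^ α                       ∎

  -- An idempotent, since 1 * 1 = 1, and nonzero.
  1^α≈1 : ∀ α → 1# ^ α ≈ 1#
  1^α≈1 α with y , 1^α*y≈1 ← inverse (1# ^ α) (^-≉0 α 0<1) = begin
    1# ^ α                   ≈⟨ *-identityʳ _ ⟨
    1# ^ α * 1#              ≈⟨ *-congˡ 1^α*y≈1 ⟨
    1# ^ α * (1# ^ α * y)    ≈⟨ *-assoc _ _ _ ⟨
    1# ^ α * 1# ^ α * y      ≈⟨ *-congʳ (^-distribʳ-* α 0<1 0<1) ⟨
    (1# * 1#) ^ α * y        ≈⟨ *-congʳ (^-cong (*-identityˡ 1#) refl) ⟩
    1# ^ α * y               ≈⟨ 1^α*y≈1 ⟩
    1#                       ∎

  1≤x^β : ∀ {x β} → 1# ≤ x → 0# ≤ β → 1# ≤ x ^ β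
  1≤x^β {x} {β} 1≤x 0≤β with 1# ≈? x | 0# ≈? β
  ... | yes 1≈x | _       = ≤-reflexive (trans (sym (1^α≈1 β)) (^-cong 1≈x refl))
  ... | no  _   | yes 0≈β = ≤-reflexive (trans (sym (^-zeroʳ (<-≤-trans 0<1 1≤x))) (^-cong refl 0≈β))
  ... | no  1≉x | no  0≉β = proj₁ (^-expansive (1≤x , 1≉x) (0≤β , 0≉β))

  -- Write y as x times the quotient y / x ≥ 1, whose power is at least 1.
  ^-monoˡ-≤ : ∀ {x y β} → 0# ≤ β → 0# < x → x ≤ y → x ^ β ≤ y ^ β
  ^-monoˡ-≤ {x} {y} {β} 0≤β 0<x@(0≤x , 0≉x) x≤y
    with x⁻¹ , xx⁻¹≈1 ← inverse x (λ x≈0 → 0≉x (sym x≈0)) =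
    ≤-respˡ-≈ (*-identityʳ _) (≤-respʳ-≈ (begin
      x ^ β * (x⁻¹ * y) ^ β  ≈⟨ ^-distribʳ-* β 0<x (<-≤-trans 0<1 1≤x⁻¹y) ⟨
      (x * (x⁻¹ * y)) ^ β    ≈⟨ ^-cong x*x⁻¹y≈y refl ⟩
      y ^ β                  ∎)
      (*-monoʳ-nonneg (proj₁ (^-pos β 0<x)) (1≤x^β 1≤x⁻¹y 0≤β)))
    where
    x*x⁻¹y≈y : x * (x⁻¹ * y) ≈ y
    x*x⁻¹y≈y = trans (sym (*-assoc _ _ _)) (trans (*-congʳ xx⁻¹≈1) (*-identityˡ y))
    1≤x⁻¹y : 1# ≤ x⁻¹ * y
    1≤x⁻¹y = ≤-respˡ-≈ (trans (*-comm x⁻¹ x) xx⁻¹≈1)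
               (*-monoʳ-nonneg (inverse-nonneg 0≤x xx⁻¹≈1) x≤y)

  -- With α = 1 + β, x ^ α = x * x ^ β ≤ x * (x + y) ^ β, likewise for y, and the two bounds add up.
  ^-superadditive : ∀ {x y α} → 1# ≤ α → 0# < x → 0# < y → x ^ α + y ^ α ≤ (x + y) ^ α
  ^-superadditive {x} {y} {α} 1≤α 0<x 0<y with β , 0≤β , α≈1+β ← ≤⇒difference 1≤α =
    ≤-respˡ-≈ (+-cong (sym (split 0<x)) (sym (split 0<y)))
      (≤-respʳ-≈ (trans (sym (distribʳ _ x y)) (sym (split 0<x+y)))
        (+-mono (*-monoʳ-nonneg (proj₁ 0<x) (^-monoˡ-≤ 0≤β 0<x x≤x+y))
                (*-monoʳ-nonneg (proj₁ 0<y) (^-monoˡ-≤ 0≤β 0<y y≤x+y))))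
    where
    x≤x+y = ≤-+-nonneg {x} (proj₁ 0<y)
    y≤x+y = ≤-respʳ-≈ (+-comm y x) (≤-+-nonneg {y} (proj₁ 0<x))
    0<x+y = <-≤-trans 0<x x≤x+y
    split : ∀ {z} → 0# < z → z ^ α ≈ z * z ^ β
    split {z} 0<z = trans (^-cong refl α≈1+β) (trans (^-distribˡ-+ 1# β 0<z) (*-congʳ (^-identityʳ 0<z)))

  -- Powers on [0,∞), with 0 sent to 0

  pow-0 : ∀ {α x} → x ≈ 0# → pow α x ≈ 0#
  pow-0 {α} {x} x≈0 with x ≈? 0#
  ... | yes _   = refl
  ... | no  x≉0 = contradiction x≈0 x≉0

  pow-pos : ∀ {α x} → 0# < x → pow α x ≈ x ^ α
  pow-pos {α} {x} (_ , 0≉x) with x ≈? 0#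
  ... | yes x≈0 = contradiction (sym x≈0) 0≉x
  ... | no  _   = refl

  nonneg-cases : ∀ {x} → 0# ≤ x → x ≈ 0# ⊎ 0# < x
  nonneg-cases {x} 0≤x with 0# ≈? x
  ... | yes 0≈x = inj₁ (sym 0≈x)
  ... | no  0≉x = inj₂ (0≤x , 0≉x)

  pow-cong : ∀ {α x y} → x ≈ y → pow α x ≈ pow α y
  pow-cong {α} {x} {y} x≈y with x ≈? 0# | y ≈? 0#
  ... | yes _   | yes _   = refl
  ... | yes x≈0 | no  y≉0 = contradiction (trans (sym x≈y) x≈0) y≉0
  ... | no  x≉0 | yes y≈0 = contradiction (trans x≈y y≈0) x≉0
  ... | no  _   | no  _   = ^-cong x≈y refl

  pow-nonneg : ∀ {α x} → 0# ≤ x → 0# ≤ pow α x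
  pow-nonneg {α} 0≤x with nonneg-cases 0≤x
  ... | inj₁ x≈0 = ≤-reflexive (sym (pow-0 x≈0))
  ... | inj₂ 0<x = ≤-respʳ-≈ (sym (pow-pos 0<x)) (proj₁ (^-pos α 0<x))

  pow-* : ∀ {α x y} → 0# ≤ x → 0# ≤ y → pow α (x * y) ≈ pow α x * pow α y
  pow-* {α} {x} {y} 0≤x 0≤y with nonneg-cases 0≤x | nonneg-cases 0≤y
  ... | inj₁ x≈0 | _ = trans (pow-0 (trans (*-congʳ x≈0) (zeroˡ y)))
                         (sym (trans (*-congʳ (pow-0 x≈0)) (zeroˡ _)))
  ... | inj₂ _ | inj₁ y≈0 = trans (pow-0 (trans (*-congˡ y≈0) (zeroʳ x)))
                         (sym (trans (*-congˡ (pow-0 y≈0)) (zeroʳ _)))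
  ... | inj₂ 0<x | inj₂ 0<y = begin
    pow α (x * y)        ≈⟨ pow-pos (*-pos 0<x 0<y) ⟩
    (x * y) ^ α          ≈⟨ ^-distribʳ-* α 0<x 0<y ⟩
    x ^ α * y ^ α        ≈⟨ *-cong (pow-pos 0<x) (pow-pos 0<y) ⟨
    pow α x * pow α y    ∎

  pow-superadditive : ∀ {α x y} → 1# ≤ α → 0# ≤ x → 0# ≤ y →
                      pow α x + pow α y ≤ pow α (x + y)
  pow-superadditive {α} {x} {y} 1≤α 0≤x 0≤y with nonneg-cases 0≤x | nonneg-cases 0≤y
  ... | inj₁ x≈0 | _ = ≤-reflexive (trans (+-congʳ (pow-0 x≈0)) (trans (+-identityˡ _)
                         (pow-cong (sym (trans (+-congʳ x≈0) (+-identityˡ y))))))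
  ... | inj₂ _ | inj₁ y≈0 = ≤-reflexive (trans (+-congˡ (pow-0 y≈0)) (trans (+-identityʳ _)
                         (pow-cong (sym (trans (+-congˡ y≈0) (+-identityʳ x))))))
  ... | inj₂ 0<x | inj₂ 0<y =
    ≤-respˡ-≈ (+-cong (sym (pow-pos 0<x)) (sym (pow-pos 0<y)))
      (≤-respʳ-≈ (sym (pow-pos (<-≤-trans 0<x (≤-+-nonneg 0≤y))))
        (^-superadditive 1≤α 0<x 0<y))

  -- If α fell short of 1 by d > 0, then 2 * 2 ^ d ≤ 2 ^ α * 2 ^ d = 2, although 2 ^ d > 1.
  2≤2^α⇒1≤α : ∀ {α} → 2# ≤ 2# ^ α → 1# ≤ α
  2≤2^α⇒1≤α {α} 2≤2^α = ≤-stable λ 1≰α → go (≤⇒difference (≰⇒≥ 1≰α)) 1≰α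
    where
    go : ∃[ d ] 0# ≤ d × 1# ≈ α + d → ¬ ¬ 1# ≤ α
    go (d , 0≤d , 1≈α+d) 1≰α = <⇒≱ 1<2^d (+-cancelʳ-≤ 1#
        (≤-trans (≤-respˡ-≈ (+-comm 1# _) (+-monoˡ (2# ^ d) (proj₁ 1<2^d))) 2^d+2^d≤2))
      where
      0<d : 0# < d
      0<d = 0≤d , λ 0≈d → 1≰α (≤-reflexive (trans 1≈α+d (trans (+-congˡ (sym 0≈d)) (+-identityʳ α))))
      1<2^d = ^-expansive 1<2 0<d
      2^d+2^d≤2 : 2# ^ d + 2# ^ d ≤ 2#
      2^d+2^d≤2 = ≤-respˡ-≈
        (solve 1 (λ x → x :* (con 1 :+ con 1) := x :+ x) refl (2# ^ d))
        (≤-respʳ-≈ (begin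
          2# ^ d * 2# ^ α   ≈⟨ *-comm _ _ ⟩
          2# ^ α * 2# ^ d   ≈⟨ ^-distribˡ-+ α d 0<2 ⟨
          2# ^ (α + d)      ≈⟨ ^-cong refl 1≈α+d ⟨
          2# ^ 1#           ≈⟨ ^-identityʳ 0<2 ⟩
          2#                ∎)
          (*-monoʳ-nonneg (proj₁ (^-pos d 0<2)) 2≤2^α))

  -- Quadratic forms

  sum-zero : ∀ {n} {f : Fin n → Carrier} → (∀ i → f i ≈ 0#) → sum f ≈ 0#
  sum-zero {n} f≈0 = trans (sum-cong-≋ f≈0) (sum-replicate-zero n)

  sum-single : ∀ {n} (f : Fin n → Carrier) i → (∀ j → j ≢ i → f j ≈ 0#) → sum f ≈ f i
  sum-single f zero f≈0 =
    trans (+-congˡ (sum-zero λ j → f≈0 (suc j) λ ())) (+-identityʳ (f zero))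
  sum-single f (suc i) f≈0 =
    trans (+-cong (f≈0 zero λ ()) (sum-single (f ∘ suc) i λ j j≢i → f≈0 (suc j) λ { ≡.refl → j≢i ≡.refl }))
          (+-identityˡ (f (suc i)))

  form : ∀ {n} → Matrix n → (Fin n → Carrier) → Carrier
  form A x = sum λ i → sum λ j → x i * A i j * x j

  form-cong : ∀ {n} {A B : Matrix n} {x y} → (∀ i j → A i j ≈ B i j) → (∀ i → x i ≈ y i) →
              form A x ≈ form B y
  form-cong A≈B x≈y = sum-cong-≋ λ i → sum-cong-≋ λ j → *-cong (*-cong (x≈y i) (A≈B i j)) (x≈y j)

  form-+ : ∀ {n} {A B C : Matrix n} x → (∀ i j → A i j ≈ B i j + C i j) →
           form A x ≈ form B x + form C x
  form-+ {A = A} {B} {C} x A≈B+C = begin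
    sum (λ i → sum λ j → x i * A i j * x j)
      ≈⟨ sum-cong-≋ (λ i → sum-cong-≋ λ j → trans (*-congʳ (*-congˡ (A≈B+C i j)))
           (solve 4 (λ s b c t → s :* (b :+ c) :* t := s :* b :* t :+ s :* c :* t) refl
             (x i) (B i j) (C i j) (x j))) ⟩
    sum (λ i → sum λ j → x i * B i j * x j + x i * C i j * x j)
      ≈⟨ sum-cong-≋ (λ i → ∑-distrib-+ (λ j → x i * B i j * x j) (λ j → x i * C i j * x j)) ⟩
    sum (λ i → sum (λ j → x i * B i j * x j) + sum (λ j → x i * C i j * x j))
      ≈⟨ ∑-distrib-+ (λ i → sum (λ j → x i * B i j * x j)) (λ i → sum (λ j → x i * C i j * x j)) ⟩
    form B x + form C x ∎

  psd-cong : ∀ {n} {A B : Matrix n} → (∀ i j → A i j ≈ B i j) →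
             PositiveSemidefinite A → PositiveSemidefinite B
  psd-cong A≈B psd x = ≤-respʳ-≈ (form-cong A≈B λ _ → refl) (psd x)

  -- Principal submatrices and padding with zeros along an injection

  module Embedding {m n} (ι : Fin m → Fin n) (ι-injective : Injective _≡_ _≡_ ι) where

    _∉Image : Fin n → Set
    i ∉Image = ∀ a → ι a ≢ i

    preimage? : ∀ i → Dec (∃[ a ] ι a ≡ i)
    preimage? i = any? λ a → ι a ≟ i

    -- Double counting: spread f over the graph of ι and exchange the two sums. Every row, and every
    -- column over the image, then has a single term that can be nonzero.
    sum-restrict : (f : Fin n → Carrier) → (∀ i → i ∉Image → f i ≈ 0#) → sum f ≈ sum (f ∘ ι)
    sum-restrict f f≈0 = begin
      sum f                                ≈⟨ sum-cong-≋ (sym ∘ column) ⟩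
      sum (λ i → sum λ a → δ a i)          ≈⟨ ∑-comm (λ i a → δ a i) ⟩
      sum (λ a → sum λ i → δ a i)          ≈⟨ sum-cong-≋ row ⟩
      sum (f ∘ ι)                          ∎
      where
      select : ∀ {P : Set} → Dec P → Carrier → Carrier
      select (yes _) x = x
      select (no _)  _ = 0#

      select-yes : ∀ {P : Set} (d : Dec P) {x} → P → select d x ≈ x
      select-yes (yes _) _ = refl
      select-yes (no ¬p) p = contradiction p ¬p

      select-no : ∀ {P : Set} (d : Dec P) {x} → ¬ P → select d x ≈ 0#
      select-no (yes p) ¬p = contradiction p ¬p
      select-no (no _)  _  = refl

      select-zero : ∀ {P : Set} (d : Dec P) {x} → x ≈ 0# → select d x ≈ 0#
      select-zero (yes _) x≈0 = x≈0
      select-zero (no _)  _   = refl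

      δ : Fin m → Fin n → Carrier
      δ a i = select (ι a ≟ i) (f i)

      row : ∀ a → sum (δ a) ≈ f (ι a)
      row a = trans (sum-single (δ a) (ι a) λ i i≢ → select-no (ι a ≟ i) (i≢ ∘ ≡.sym))
                    (select-yes (ι a ≟ ι a) ≡.refl)

      column : ∀ i → sum (λ a → δ a i) ≈ f i
      column i with preimage? i
      ... | yes (a , ≡.refl) =
        trans (sum-single (λ b → δ b (ι a)) a λ b b≢a → select-no (ι b ≟ ι a) (b≢a ∘ ι-injective))
              (select-yes (ι a ≟ ι a) ≡.refl)
      ... | no i∉ = let fi≈0 = f≈0 i (λ a eq → i∉ (a , eq)) in
        trans (sum-zero λ a → select-zero (ι a ≟ i) fi≈0) (sym fi≈0)

    -- The hypothesis concerns whole terms, so that it covers matrices that vanish off the image as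
    -- well as vectors that do.
    form-restrict : (A : Matrix n) (x : Fin n → Carrier) →
                    (∀ i j → i ∉Image ⊎ j ∉Image → x i * A i j * x j ≈ 0#) →
                    form A x ≈ form (A on ι) (x ∘ ι)
    form-restrict A x vanish = begin
      sum (λ i → sum λ j → x i * A i j * x j)
        ≈⟨ sum-cong-≋ (λ i → sum-restrict _ λ j j∉ → vanish i j (inj₂ j∉)) ⟩
      sum (λ i → sum λ b → x i * A i (ι b) * x (ι b))
        ≈⟨ sum-restrict _ (λ i i∉ → sum-zero λ b → vanish i (ι b) (inj₁ i∉)) ⟩
      form (A on ι) (x ∘ ι) ∎

    extend : (Fin m → Carrier) → Fin n → Carrier
    extend x i with preimage? i
    ... | yes (a , _) = x a
    ... | no _        = 0#

    extend-on : ∀ x a → extend x (ι a) ≡ x a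
    extend-on x a with preimage? (ι a)
    ... | yes (b , ιb≡ιa) = ≡.cong x (ι-injective ιb≡ιa)
    ... | no  ∄a          = contradiction (a , ≡.refl) ∄a

    extend-off : ∀ x {i} → i ∉Image → extend x i ≡ 0#
    extend-off x {i} i∉ with preimage? i
    ... | yes (a , ιa≡i) = contradiction ιa≡i (i∉ a)
    ... | no  _          = ≡.refl

    extendMatrix : Matrix m → Matrix n
    extendMatrix E i j = extend (λ a → extend (E a) j) i

    extendMatrix-on : ∀ E a b → extendMatrix E (ι a) (ι b) ≡ E a b
    extendMatrix-on E a b = ≡.trans (extend-on _ a) (extend-on (E a) b)

    extendMatrix-off : ∀ E {i j} → i ∉Image ⊎ j ∉Image → extendMatrix E i j ≡ 0#
    extendMatrix-off E (inj₁ i∉) = extend-off _ i∉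
    extendMatrix-off E {i} {j} (inj₂ j∉) with preimage? i
    ... | yes (a , _) = extend-off (E a) j∉
    ... | no _        = ≡.refl

    extendMatrix-elim : ∀ {p} {P : Fin n → Fin n → Carrier → Set p} E →
                        (∀ a b → P (ι a) (ι b) (E a b)) → (∀ i j → P i j 0#) →
                        ∀ i j → P i j (extendMatrix E i j)
    extendMatrix-elim {P = P} E on off i j = go (preimage? i) (preimage? j)
      where
      go : Dec (∃[ a ] ι a ≡ i) → Dec (∃[ b ] ι b ≡ j) → P i j (extendMatrix E i j)
      go (yes (a , ≡.refl)) (yes (b , ≡.refl)) =
        ≡.subst (P i j) (≡.sym (extendMatrix-on E a b)) (on a b)
      go (no ∄a) _ = ≡.subst (P i j) (≡.sym (extendMatrix-off E (inj₁ λ a eq → ∄a (a , eq)))) (off i j)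
      go _ (no ∄b) = ≡.subst (P i j) (≡.sym (extendMatrix-off E (inj₂ λ b eq → ∄b (b , eq)))) (off i j)

    form-supported : (A : Matrix n) → (∀ i j → i ∉Image ⊎ j ∉Image → A i j ≈ 0#) →
                     ∀ x → form A x ≈ form (A on ι) (x ∘ ι)
    form-supported A vanish x = form-restrict A x λ i j off →
      trans (*-congʳ (trans (*-congˡ (vanish i j off)) (zeroʳ (x i)))) (zeroˡ (x j))

    form-extendMatrix : ∀ E x → form (extendMatrix E) x ≈ form E (x ∘ ι)
    form-extendMatrix E x = trans
      (form-supported (extendMatrix E) (λ i j off → reflexive (extendMatrix-off E off)) x)
      (form-cong (λ a b → reflexive (extendMatrix-on E a b)) λ _ → refl)

    psd-principal : ∀ {A} → PositiveSemidefinite A → PositiveSemidefinite (A on ι)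
    psd-principal {A} psd x = ≤-respʳ-≈ (trans
      (form-restrict A (extend x) λ
        { i j (inj₁ i∉) → trans (*-congʳ (trans (*-congʳ (reflexive (extend-off x i∉))) (zeroˡ _))) (zeroˡ _)
        ; i j (inj₂ j∉) → trans (*-congˡ (reflexive (extend-off x j∉))) (zeroʳ _) })
      (form-cong (λ _ _ → refl) λ a → reflexive (extend-on x a)))
      (psd (extend x))

  point : ∀ {n} → Fin n → Fin 1 → Fin n
  point i _ = i

  point-injective : ∀ {n} (i : Fin n) → Injective _≡_ _≡_ (point i)
  point-injective i {0F} {0F} _ = ≡.refl

  psd-diagonal : ∀ {n} {A : Matrix n} → PositiveSemidefinite A → ∀ i → 0# ≤ A i i
  psd-diagonal {A = A} psd i = ≤-respʳ-≈
    (solve 1 (λ a → con 1 :* a :* con 1 :+ con 0 :+ con 0 := a) refl (A i i))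
    (psd-principal psd λ _ → 1#)
    where open Embedding (point i) (point-injective i)

  pair : ∀ {n} → Fin n → Fin n → Fin 2 → Fin n
  pair v p 0F = v
  pair v p 1F = p

  pair-injective : ∀ {n} {v p : Fin n} → v ≢ p → Injective _≡_ _≡_ (pair v p)
  pair-injective v≢p {0F} {0F} _  = ≡.refl
  pair-injective v≢p {0F} {1F} eq = contradiction eq v≢p
  pair-injective v≢p {1F} {0F} eq = contradiction (≡.sym eq) v≢p
  pair-injective v≢p {1F} {1F} _  = ≡.refl

  binaryForm : Carrier → Carrier → Carrier → Carrier → Carrier → Carrier
  binaryForm a b d s t = a * (s * s) + (b * (s * t) + b * (s * t)) + d * (t * t)

  matrix₂ : Carrier → Carrier → Carrier → Matrix 2
  matrix₂ a b d 0F 0F = a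
  matrix₂ a b d 0F 1F = b
  matrix₂ a b d 1F 0F = b
  matrix₂ a b d 1F 1F = d

  form-matrix₂ : ∀ a b d x → form (matrix₂ a b d) x ≈ binaryForm a b d (x 0F) (x 1F)
  form-matrix₂ a b d x = solve 5 (λ a b d s t →
      s :* a :* s :+ (s :* b :* t :+ con 0) :+ (t :* b :* s :+ (t :* d :* t :+ con 0) :+ con 0)
      := a :* (s :* s) :+ (b :* (s :* t) :+ b :* (s :* t)) :+ d :* (t :* t))
    refl a b d (x 0F) (x 1F)

  psd-binaryForm : ∀ {n} {A : Matrix n} {v p} → PositiveSemidefinite A → (∀ i j → A i j ≈ A j i) →
                   v ≢ p → ∀ s t → 0# ≤ binaryForm (A v v) (A v p) (A p p) s t
  psd-binaryForm {A = A} {v} {p} psd A-sym v≢p s t = ≤-respʳ-≈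
    (trans (form-cong {x = st} {st} entry λ _ → refl) (form-matrix₂ _ _ _ st))
    (psd-principal psd st)
    where
    open Embedding (pair v p) (pair-injective v≢p)
    st : Fin 2 → Carrier
    st 0F = s
    st 1F = t
    entry : ∀ i j → A (pair v p i) (pair v p j) ≈ matrix₂ (A v v) (A v p) (A p p) i j
    entry 0F 0F = refl
    entry 0F 1F = refl
    entry 1F 0F = A-sym p v
    entry 1F 1F = refl

  psd-zeroDiagonal : ∀ {n} {A : Matrix n} {v p} → PositiveSemidefinite A → (∀ i j → A i j ≈ A j i) →
                     v ≢ p → A v v ≈ 0# → A v p ≈ 0#
  psd-zeroDiagonal {A = A} {v} {p} psd A-sym v≢p Avv≈0 =
    decidable-stable (A v p ≈? 0#) λ b≉0 → go (inverse (A v p) b≉0)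
    where
    a = A p p
    b = A v p
    go : ¬ (∃[ y ] b * y ≈ 1#)
    go (y , by≈1) = <⇒≱ (0<1) (≤-trans (≤-+-nonneg (+-nonneg (psd-diagonal psd p) (0≤1)))
        (≤-respˡ-≈ (+-identityˡ _) (≤-respʳ-≈ negative (+-monoˡ _ (psd-binaryForm psd A-sym v≢p s 1#)))))
      where
      -- With y = 1 / b this makes 2 b s + a equal to -(a + 2), which is negative because a is a
      -- diagonal entry.
      s = - (y * (a + 1#))
      negative : binaryForm (A v v) b a s 1# + (1# + (a + 1#)) ≈ 0#
      negative = begin
        binaryForm (A v v) b a s 1# + (1# + (a + 1#))
          ≈⟨ +-congʳ (+-congʳ (+-congʳ (trans (*-congʳ Avv≈0) (zeroˡ _)))) ⟩
        0# + (b * (s * 1#) + b * (s * 1#)) + a * (1# * 1#) + (1# + (a + 1#))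
          ≈⟨ solve 3 (λ b s a → con 0 :+ (b :* (s :* con 1) :+ b :* (s :* con 1)) :+ a :* (con 1 :* con 1) :+ (con 1 :+ (a :+ con 1))
               := (b :* s :+ (a :+ con 1)) :+ (b :* s :+ (a :+ con 1))) refl b s a ⟩
        (b * s + (a + 1#)) + (b * s + (a + 1#))
          ≈⟨ +-cong cancel cancel ⟩
        0# + 0#
          ≈⟨ +-identityˡ 0# ⟩
        0# ∎
        where
        cancel : b * s + (a + 1#) ≈ 0#
        cancel = begin
          b * - (y * (a + 1#)) + (a + 1#)     ≈⟨ +-congʳ (-‿distribʳ-* b _) ⟨
          - (b * (y * (a + 1#))) + (a + 1#)   ≈⟨ +-congʳ (-‿cong (trans (sym (*-assoc _ _ _)) (trans (*-congʳ by≈1) (*-identityˡ _)))) ⟩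
          - (a + 1#) + (a + 1#)               ≈⟨ -‿inverseˡ _ ⟩
          0#                                  ∎

  -- Schur complements

  -- Completing the square, with d in the role of 1 / c. Both alternatives enter only through c d b
  -- = b, which lets a vanishing pivot be treated like any other.
  binaryForm-square : ∀ {c d b} → c * d ≈ 1# ⊎ (b ≈ 0# × d ≈ 0#) → ∀ s t →
                      binaryForm c b (b * b * d) s t ≈ c * ((s + d * b * t) * (s + d * b * t))
  binaryForm-square {c} {d} {b} inv s t = sym (begin
    c * ((s + d * b * t) * (s + d * b * t))
      ≈⟨ solve 5 (λ c d b s t → c :* ((s :+ d :* b :* t) :* (s :+ d :* b :* t))
           := c :* (s :* s) :+ (c :* d :* b :* (s :* t) :+ c :* d :* b :* (s :* t)) :+ b :* (c :* d :* b) :* d :* (t :* t))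
           refl c d b s t ⟩
    binaryForm c (c * d * b) (b * (c * d * b) * d) s t
      ≈⟨ +-cong (+-congˡ (+-cong (*-congʳ cdb≈b) (*-congʳ cdb≈b))) (*-congʳ (*-congʳ (*-congˡ cdb≈b))) ⟩
    binaryForm c b (b * b * d) s t ∎)
    where
    cdb≈b : c * d * b ≈ b
    cdb≈b = [ (λ cd≈1 → trans (*-congʳ cd≈1) (*-identityˡ b))
            , (λ (b≈0 , _) → trans (trans (*-congˡ b≈0) (zeroʳ _)) (sym b≈0)) ]′ inv

  -- Raising the last coefficient above b² d adds a nonnegative multiple of t² to the completed
  -- square.
  binaryForm-nonneg : ∀ {c d b δ} → 0# ≤ c → c * d ≈ 1# ⊎ (b ≈ 0# × d ≈ 0#) →
                      b * b * d ≤ δ → ∀ s t → 0# ≤ binaryForm c b δ s t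
  binaryForm-nonneg {c} {d} {b} {δ} 0≤c inv le s t with σ , 0≤σ , δ≈ ← ≤⇒difference le =
    ≤-respʳ-≈ (begin
      c * ((s + d * b * t) * (s + d * b * t)) + σ * (t * t)
        ≈⟨ +-congʳ (binaryForm-square inv s t) ⟨
      binaryForm c b (b * b * d) s t + σ * (t * t)
        ≈⟨ solve 4 (λ x y z w → x :+ y :* w :+ z :* w := x :+ (y :+ z) :* w) refl
             (c * (s * s) + (b * (s * t) + b * (s * t))) (b * b * d) σ (t * t) ⟩
      c * (s * s) + (b * (s * t) + b * (s * t)) + (b * b * d + σ) * (t * t)
        ≈⟨ +-congˡ (*-congʳ δ≈) ⟨
      binaryForm c b δ s t ∎)
      (+-nonneg (*-nonneg 0≤c (square-nonneg _)) (*-nonneg 0≤σ (square-nonneg t)))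

  -- The Schur complement at a leaf in unchanged size: row and column `v` are zeroed instead of
  -- deleted, and `e` is the new entry at (p , p).
  module Pruning {n} (A : Matrix n) (v p : Fin n) (e : Carrier) where

    pruneEntry : ∀ {P Q R S : Set} → Dec P → Dec Q → Dec R → Dec S → Carrier → Carrier
    pruneEntry (yes _) _       _       _       _ = 0#
    pruneEntry (no _)  (yes _) _       _       _ = 0#
    pruneEntry (no _)  (no _)  (yes _) (yes _) _ = e
    pruneEntry (no _)  (no _)  (yes _) (no _)  a = a
    pruneEntry (no _)  (no _)  (no _)  _       a = a

    prune : Matrix n
    prune i j = pruneEntry (i ≟ v) (j ≟ v) (i ≟ p) (j ≟ p) (A i j)

    prune-elim : ∀ {q} {P : Fin n → Fin n → Carrier → Set q} →
                 (∀ i j → P i j 0#) → P p p e → (∀ i j → i ≢ v → P i j (A i j)) →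
                 ∀ i j → P i j (prune i j)
    prune-elim erased corner old i j with i ≟ v | j ≟ v | i ≟ p | j ≟ p
    ... | yes _  | _     | _          | _          = erased i j
    ... | no _   | yes _ | _          | _          = erased i j
    ... | no _   | no _  | yes ≡.refl | yes ≡.refl = corner
    ... | no i≢v | no _  | yes _      | no _       = old i j i≢v
    ... | no i≢v | no _  | no _       | _          = old i j i≢v

    prune-row : ∀ {i j} → i ≡ v → prune i j ≡ 0#
    prune-row {i} i≡v with i ≟ v
    ... | yes _  = ≡.refl
    ... | no i≢v = contradiction i≡v i≢v

    prune-column : ∀ {i j} → j ≡ v → prune i j ≡ 0#
    prune-column {i} {j} j≡v with i ≟ v | j ≟ v
    ... | yes _ | _      = ≡.refl
    ... | no _  | yes _  = ≡.refl
    ... | no _  | no j≢v = contradiction j≡v j≢v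

    prune-corner : v ≢ p → prune p p ≡ e
    prune-corner v≢p with p ≟ v | p ≟ p
    ... | yes p≡v | _     = contradiction (≡.sym p≡v) v≢p
    ... | no _    | yes _ = ≡.refl
    ... | no _    | no ne = contradiction ≡.refl ne

    prune-symmetric : (∀ i j → A i j ≈ A j i) → ∀ i j → prune i j ≈ prune j i
    prune-symmetric A-sym i j with i ≟ v | j ≟ v | i ≟ p | j ≟ p
    ... | yes _ | yes _ | _     | _     = refl
    ... | yes _ | no _  | _     | _     = refl
    ... | no _  | yes _ | _     | _     = refl
    ... | no _  | no _  | yes _ | yes _ = refl
    ... | no _  | no _  | yes _ | no _  = A-sym i j
    ... | no _  | no _  | no _  | yes _ = A-sym i j
    ... | no _  | no _  | no _  | no _  = A-sym i j

    module _ (A-sym : ∀ i j → A i j ≈ A j i) (v≢p : v ≢ p)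
             (leaf : ∀ j → j ≢ v → j ≢ p → A v j ≈ 0#)
             (g : Carrier → Carrier) (g-cong : ∀ {x y} → x ≈ y → g x ≈ g y) (g-0 : g 0# ≈ 0#)
             (δ : Carrier) (g-corner : g (A p p) ≈ g e + δ) where
      open Embedding (pair v p) (pair-injective v≢p)

      private
        E : Matrix 2
        E = matrix₂ (g (A v v)) (g (A v p)) δ

        new : ∀ {x y} → x ≈ y → x ≈ g 0# + y
        new {x} {y} x≈y = trans x≈y (trans (sym (+-identityˡ y)) (+-congʳ (sym g-0)))

        old : ∀ {x y} → y ≡ 0# → x ≈ x + y
        old {x} y≡0 = trans (sym (+-identityʳ x)) (+-congˡ (reflexive (≡.sym y≡0)))

        off : ∀ {i} → i ≢ v → i ≢ p → i ∉Image
        off i≢v i≢p 0F eq = i≢v (≡.sym eq)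
        off i≢v i≢p 1F eq = i≢p (≡.sym eq)

        on : ∀ a b → E a b ≈ extendMatrix E (pair v p a) (pair v p b)
        on a b = reflexive (≡.sym (extendMatrix-on E a b))

        outside : ∀ {i j} → i ∉Image ⊎ j ∉Image → 0# ≈ extendMatrix E i j
        outside o = reflexive (≡.sym (extendMatrix-off E o))

      -- Used twice: g = id with δ = b² d is the Schur decomposition of `A`; g = f with a possibly
      -- different δ compares the images of `A` and `prune`.
      prune-decompose : ∀ i j → g (A i j) ≈ g (prune i j) + extendMatrix E i j
      prune-decompose i j with i ≟ v | j ≟ v | i ≟ p | j ≟ p
      ... | yes ≡.refl | yes ≡.refl | _          | _          = new (on 0F 0F)
      ... | yes ≡.refl | no _       | _          | yes ≡.refl = new (on 0F 1F)
      ... | yes ≡.refl | no j≢v     | _          | no j≢p     =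
        new (trans (trans (g-cong (leaf j j≢v j≢p)) g-0) (outside (inj₂ (off j≢v j≢p))))
      ... | no _       | yes ≡.refl | yes ≡.refl | _          = new (trans (g-cong (A-sym p v)) (on 1F 0F))
      ... | no i≢v     | yes ≡.refl | no i≢p     | _          =
        new (trans (trans (g-cong (trans (A-sym i v) (leaf i i≢v i≢p))) g-0) (outside (inj₁ (off i≢v i≢p))))
      ... | no _       | no _       | yes ≡.refl | yes ≡.refl = trans g-corner (+-congˡ (on 1F 1F))
      ... | no _       | no j≢v     | yes ≡.refl | no j≢p     = old (extendMatrix-off E (inj₂ (off j≢v j≢p)))
      ... | no i≢v     | no _       | no i≢p     | _          = old (extendMatrix-off E (inj₁ (off i≢v i≢p)))

      form-decompose : ∀ x → form (g [ A ]) x ≈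
                       form (g [ prune ]) x + binaryForm (g (A v v)) (g (A v p)) δ (x v) (x p)
      form-decompose x = trans (form-+ x prune-decompose)
        (+-congˡ (trans (form-extendMatrix E x) (form-matrix₂ _ _ _ (x ∘ pair v p))))

    -- This leaves the coordinate at v free, to be chosen optimally in `prune-psd`.
    form-prune-cong : ∀ {x y} → (∀ i → i ≢ v → x i ≈ y i) → form prune x ≈ form prune y
    form-prune-cong {x} {y} x≈y = sum-cong-≋ λ i → sum-cong-≋ λ j → entry i j
      where
      vanish : ∀ {a b c d m} → m ≡ 0# → a * m * b ≈ c * m * d
      vanish {a} {b} {c} {d} ≡.refl =
        trans (trans (*-congʳ (zeroʳ a)) (zeroˡ b)) (sym (trans (*-congʳ (zeroʳ c)) (zeroˡ d)))
      entry : ∀ i j → x i * prune i j * x j ≈ y i * prune i j * y j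
      entry i j = by-cases (i ≟ v) (j ≟ v)
        where
        by-cases : Dec (i ≡ v) → Dec (j ≡ v) → x i * prune i j * x j ≈ y i * prune i j * y j
        by-cases (yes i≡v) _        = vanish (prune-row i≡v)
        by-cases _        (yes j≡v) = vanish (prune-column {i} j≡v)
        by-cases (no i≢v) (no j≢v) = *-cong (*-congʳ (x≈y i i≢v)) (x≈y j j≢v)

  module Schur {n} (A : Matrix n) (A-psd : PositiveSemidefinite A) (A-sym : ∀ i j → A i j ≈ A j i)
               (v p : Fin n) (v≢p : v ≢ p) (leaf : ∀ j → j ≢ v → j ≢ p → A v j ≈ 0#) where

    -- If the pivot A v v vanishes, then so does A v p, and 0 serves as its inverse.
    pivotInverse : ∃[ d ] 0# ≤ d × (A v v * d ≈ 1# ⊎ (A v p ≈ 0# × d ≈ 0#))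
    pivotInverse with A v v ≈? 0#
    ... | yes c≈0 = 0# , ≤-refl , inj₂ (psd-zeroDiagonal A-psd A-sym v≢p c≈0 , refl)
    ... | no  c≉0 with d , cd≈1 ← inverse (A v v) c≉0 =
      d , inverse-nonneg (psd-diagonal A-psd v) cd≈1 , inj₁ cd≈1

    b d e : Carrier
    b = A v p
    d = proj₁ pivotInverse
    e = A p p - b * b * d

    corner : A p p ≈ e + b * b * d
    corner = begin
      A p p                                  ≈⟨ +-identityʳ _ ⟨
      A p p + 0#                             ≈⟨ +-congˡ (-‿inverseˡ _) ⟨
      A p p + (- (b * b * d) + b * b * d)    ≈⟨ +-assoc _ _ _ ⟨
      e + b * b * d                          ∎

    open Pruning A v p e public

    -- Replacing the coordinate at v by -(d b x p) makes the completed square vanish, and the form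
    -- of `A` there is the form of `prune`.
    prune-psd : PositiveSemidefinite prune
    prune-psd x = ≤-respʳ-≈ (begin
      form A y
        ≈⟨ form-decompose A-sym v≢p leaf id id refl (b * b * d) corner y ⟩
      form prune y + binaryForm (A v v) b (b * b * d) (y v) (y p)
        ≈⟨ +-congˡ (trans (binaryForm-square (proj₂ (proj₂ pivotInverse)) (y v) (y p))
             (trans (*-congˡ (trans (*-congʳ y-kills) (zeroˡ _))) (zeroʳ _))) ⟩
      form prune y + 0#
        ≈⟨ +-identityʳ _ ⟩
      form prune y
        ≈⟨ form-prune-cong {y} {x} (λ i i≢v → reflexive (y-off i i≢v)) ⟩
      form prune x ∎)
      (A-psd y)
      where
      y : Fin n → Carrier
      y i with i ≟ v
      ... | yes _ = - (d * b * x p)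
      ... | no _  = x i

      y-on : y v ≡ - (d * b * x p)
      y-on with v ≟ v
      ... | yes _ = ≡.refl
      ... | no ne = contradiction ≡.refl ne

      y-off : ∀ i → i ≢ v → y i ≡ x i
      y-off i i≢v with i ≟ v
      ... | yes i≡v = contradiction i≡v i≢v
      ... | no _    = ≡.refl

      y-kills : y v + d * b * y p ≈ 0#
      y-kills = trans (+-cong (reflexive y-on) (*-congˡ (reflexive (y-off p (v≢p ∘ ≡.sym))))) (-‿inverseˡ _)

    -- Keeps the new entry inside I even for I = [0,∞), and makes superadditivity applicable to it.
    e-nonneg : 0# ≤ e
    e-nonneg = ≤-respʳ-≈ (reflexive (prune-corner v≢p)) (psd-diagonal prune-psd p)

  -- Entrywise functions preserving positivity

  -- What the leaf argument uses of f. Apart from congruence, only `square` constrains f at negative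
  -- arguments, and it ignores the sign.
  record PowerLike {i} (I : Pred Carrier i) (α : Carrier) (f : Carrier → Carrier) : Set (c ⊔ ℓ ⊔ i) where
    field
      nonneg∈ : ∀ {x} → 0# ≤ x → x ∈ I
      cong    : ∀ {x y} → x ≈ y → f x ≈ f y
      nonneg  : ∀ {x} → 0# ≤ x → f x ≈ pow α x
      square  : ∀ {x} → x ∈ I → f x * f x ≈ pow α (x * x)

  module Preservation {i} {I : Pred Carrier i} {α f} (powerLike : PowerLike I α f) where
    open PowerLike powerLike renaming (cong to f-cong; nonneg to f-nonneg; square to f-square)

    f-0 : ∀ {x} → x ≈ 0# → f x ≈ 0#
    f-0 x≈0 = trans (f-nonneg (≤-reflexive (sym x≈0))) (pow-0 x≈0)

    0∈I : 0# ∈ I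
    0∈I = nonneg∈ ≤-refl

    Preserves : ∀ {n} → Graph n → Set (c ⊔ ℓ ⊔ i)
    Preserves G = ∀ A → 𝓟 G I A → 𝓟 G U (f [ A ])

    image-𝓟 : ∀ {n} {G : Graph n} {A} → 𝓟 G I A → PositiveSemidefinite (f [ A ]) → 𝓟 G U (f [ A ])
    image-𝓟 A∈ psd = record
      { symmetric = λ i j → f-cong (symmetric i j)
      ; positive  = psd
      ; entries   = λ _ _ → tt
      ; zeros     = λ i j i≢j i≁j → f-0 (zeros i j i≢j i≁j)
      }
      where open 𝓟 A∈

    -- Pad the matrix with zeros and restrict its image again. The subgraph need not be induced, as
    -- entries at further edges may be zero.
    preserves-subgraph : ∀ {m n} {G′ : Graph m} {G : Graph n} (ι : Fin m → Fin n) → Injective _≡_ _≡_ ι →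
                         (∀ {a b} → Graph._~_ G′ a b → Graph._~_ G (ι a) (ι b)) →
                         Preserves G → Preserves G′
    preserves-subgraph {G′ = G′} {G} ι ι-injective hom G-preserves A′ A′∈ = image-𝓟 A′∈
      (psd-cong (λ a b → f-cong (reflexive (extendMatrix-on A′ a b)))
        (psd-principal (𝓟.positive (G-preserves A A∈))))
      where
      open Embedding ι ι-injective
      A = extendMatrix A′
      open 𝓟 A′∈
      A∈ : 𝓟 G I A
      A∈ = record
        { symmetric = extendMatrix-symmetric
        ; positive  = λ x → ≤-respʳ-≈ (sym (form-extendMatrix A′ x)) (positive (x ∘ ι))
        ; entries   = extendMatrix-elim {P = λ _ _ x → x ∈ I} A′ entries (λ _ _ → 0∈I)
        ; zeros     = extendMatrix-elim {P = λ i j x → i ≢ j → ¬ Graph._~_ G i j → x ≈ 0#} A′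
                        (λ a b a≢b a≁b → zeros a b (a≢b ∘ ≡.cong ι) (a≁b ∘ hom))
                        (λ _ _ _ _ → refl)
        }
        where
        extendMatrix-symmetric : ∀ i j → A i j ≈ A j i
        extendMatrix-symmetric i j = go (preimage? i) (preimage? j)
          where
          go : Dec (∃[ a ] ι a ≡ i) → Dec (∃[ b ] ι b ≡ j) → A i j ≈ A j i
          go (yes (a , ≡.refl)) (yes (b , ≡.refl)) =
            trans (reflexive (extendMatrix-on A′ a b))
              (trans (symmetric a b) (reflexive (≡.sym (extendMatrix-on A′ b a))))
          go (no ∄a) _ = let i∉ = λ a eq → ∄a (a , eq) in
            reflexive (≡.trans (extendMatrix-off A′ (inj₁ i∉)) (≡.sym (extendMatrix-off A′ (inj₂ i∉))))
          go _ (no ∄b) = let j∉ = λ b eq → ∄b (b , eq) in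
            reflexive (≡.trans (extendMatrix-off A′ (inj₂ j∉)) (≡.sym (extendMatrix-off A′ (inj₁ j∉))))

    -- On [[2,1,1],[1,1,0],[1,0,1]], placed at v, a, b, the image under f takes the
    -- value 2 ^ α - 2 at (1,-1,-1).
    preserves-cherry : ∀ {n} {G : Graph n} → Cherry G → Preserves G → 1# ≤ α
    preserves-cherry {n} {G} (v , a , b , a≢b , v~a , v~b) G-preserves = 2≤2^α⇒1≤α
      (≤-respˡ-≈ (+-identityˡ 2#) (≤-respʳ-≈ evaluate
        (+-monoˡ 2# (psd-cong f-entries (𝓟.positive (star-preserves M M∈)) x))))
      where
      open Graph G using (_~_; irrefl) renaming (sym to ~-sym)

      -- The path with middle vertex 0F.
      star : Graph 3
      star .Graph._~_ i j  = does (i ≟ 0F) ≢ does (j ≟ 0F)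
      star .Graph._~?_ i j = ¬? (does (i ≟ 0F) ≟ᵇ does (j ≟ 0F))
      star .Graph.sym      = ≡.≢-sym
      star .Graph.irrefl ≡.refl ne = ne ≡.refl

      ι : Fin 3 → Fin n
      ι 0F = v
      ι 1F = a
      ι 2F = b

      ι-injective : Injective _≡_ _≡_ ι
      ι-injective {0F} {0F} _  = ≡.refl
      ι-injective {0F} {1F} eq = contradiction v~a (irrefl eq)
      ι-injective {0F} {2F} eq = contradiction v~b (irrefl eq)
      ι-injective {1F} {0F} eq = contradiction v~a (irrefl (≡.sym eq))
      ι-injective {1F} {1F} _  = ≡.refl
      ι-injective {1F} {2F} eq = contradiction eq a≢b
      ι-injective {2F} {0F} eq = contradiction v~b (irrefl (≡.sym eq))
      ι-injective {2F} {1F} eq = contradiction (≡.sym eq) a≢b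
      ι-injective {2F} {2F} _  = ≡.refl

      ι-hom : ∀ {i j} → star .Graph._~_ i j → ι i ~ ι j
      ι-hom {0F}    {0F}    ne = contradiction ≡.refl ne
      ι-hom {0F}    {1F}    _  = v~a
      ι-hom {0F}    {2F}    _  = v~b
      ι-hom {1F}    {0F}    _  = ~-sym v~a
      ι-hom {2F}    {0F}    _  = ~-sym v~b
      ι-hom {suc _} {suc _} ne = contradiction ≡.refl ne

      star-preserves : Preserves star
      star-preserves = preserves-subgraph {G′ = star} {G} ι ι-injective (λ {i} {j} → ι-hom {i} {j}) G-preserves

      starMatrix : Carrier → Matrix 3
      starMatrix t 0F      0F      = t
      starMatrix t 0F      (suc _) = 1#
      starMatrix t (suc _) 0F      = 1#
      starMatrix t 1F      1F      = 1#
      starMatrix t 1F      2F      = 0#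
      starMatrix t 2F      1F      = 0#
      starMatrix t 2F      2F      = 1#

      M : Matrix 3
      M = starMatrix 2#

      M∈ : 𝓟 star I M
      M∈ = record
        { symmetric = λ { 0F 0F → refl ; 0F (suc _) → refl ; (suc _) 0F → refl
                        ; 1F 1F → refl ; 1F 2F → refl ; 2F 1F → refl ; 2F 2F → refl }
        ; positive  = λ y → ≤-respʳ-≈
            (solve 3 (λ s t u → (s :+ t) :* (s :+ t) :+ (s :+ u) :* (s :+ u) :=
              (s :* (con 1 :+ con 1) :* s :+ (s :* con 1 :* t :+ (s :* con 1 :* u :+ con 0))) :+
              ((t :* con 1 :* s :+ (t :* con 1 :* t :+ (t :* con 0 :* u :+ con 0))) :+
              ((u :* con 1 :* s :+ (u :* con 0 :* t :+ (u :* con 1 :* u :+ con 0))) :+ con 0)))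
              refl (y 0F) (y 1F) (y 2F))
            (+-nonneg (square-nonneg (y 0F + y 1F)) (square-nonneg (y 0F + y 2F)))
        ; entries   = λ { 0F 0F → nonneg∈ (0≤2) ; 0F (suc _) → 1∈I ; (suc _) 0F → 1∈I
                        ; 1F 1F → 1∈I ; 1F 2F → 0∈I ; 2F 1F → 0∈I ; 2F 2F → 1∈I }
        ; zeros     = λ { 0F 0F ne _ → contradiction ≡.refl ne
                        ; 0F (suc _) _ ≁ → contradiction (λ ()) ≁
                        ; (suc _) 0F _ ≁ → contradiction (λ ()) ≁
                        ; 1F 1F ne _ → contradiction ≡.refl ne ; 1F 2F _ _ → refl
                        ; 2F 1F _ _ → refl ; 2F 2F ne _ → contradiction ≡.refl ne }
        }
        where 1∈I = nonneg∈ (0≤1)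

      f-1 : f 1# ≈ 1#
      f-1 = trans (f-nonneg (0≤1)) (trans (pow-pos (0<1)) (1^α≈1 α))

      f-2 : f 2# ≈ 2# ^ α
      f-2 = trans (f-nonneg (0≤2)) (pow-pos (0<2))

      f-entries : ∀ i j → f (M i j) ≈ starMatrix (2# ^ α) i j
      f-entries 0F      0F      = f-2
      f-entries 0F      (suc _) = f-1
      f-entries (suc _) 0F      = f-1
      f-entries 1F      1F      = f-1
      f-entries 1F      2F      = f-0 refl
      f-entries 2F      1F      = f-0 refl
      f-entries 2F      2F      = f-1

      -- This vector spans the kernel of `M`, whose form is (s + t)² + (s + u)². Hence positivity is
      -- lost as soon as the entry 2 decreases while the others stay.
      x : Fin 3 → Carrier
      x 0F      = 1#
      x (suc _) = - 1#

      evaluate : form (starMatrix (2# ^ α)) x + 2# ≈ 2# ^ α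
      evaluate = begin
        form (starMatrix (2# ^ α)) x + 2#
          -- Here u stands for -1; the added 2 completes 2 u² + 4 u to 2 (1 + u)², which vanishes.
          ≈⟨ solve 2 (λ t u →
              (con 1 :* t :* con 1 :+ (con 1 :* con 1 :* u :+ (con 1 :* con 1 :* u :+ con 0))) :+
              ((u :* con 1 :* con 1 :+ (u :* con 1 :* u :+ (u :* con 0 :* u :+ con 0))) :+
              ((u :* con 1 :* con 1 :+ (u :* con 0 :* u :+ (u :* con 1 :* u :+ con 0))) :+ con 0))
              :+ (con 1 :+ con 1)
              := t :+ (con 1 :+ con 1) :* (con 1 :+ u) :* (con 1 :+ u)) refl (2# ^ α) (- 1#) ⟩
        2# ^ α + 2# * (1# + - 1#) * (1# + - 1#)
          ≈⟨ +-congˡ (trans (*-congˡ (-‿inverseʳ 1#)) (zeroʳ _)) ⟩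
        2# ^ α + 0#
          ≈⟨ +-identityʳ _ ⟩
        2# ^ α ∎

    -- Preservation for the subgraph induced on S, without renumbering its vertices. Vanishing rows
    -- suffice, since symmetry takes care of the columns.
    PreservesOn : ∀ {n} → Graph n → Pred (Fin n) 0ℓ → Set (c ⊔ ℓ ⊔ i)
    PreservesOn G S = ∀ A → 𝓟 G I A → (∀ i j → i ∉ S → A i j ≈ 0#) → PositiveSemidefinite (f [ A ])

    -- The Schur complement at v is supported on S, where preservation is known; the remaining
    -- binary form is nonnegative by superadditivity.
    preservesOn-leaf : 1# ≤ α → ∀ {n} {G : Graph n} {S v p} → v ≢ p → p ∈ S →
                       (∀ {w} → w ∈ S → Graph._~_ G v w → w ≡ p) →
                       PreservesOn G S → PreservesOn G (λ w → w ≡ v ⊎ w ∈ S)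
    preservesOn-leaf 1≤α {G = G} {S} {v} {p} v≢p p∈S unique S-preserves A A∈ A-support x =
      ≤-respʳ-≈ (sym (form-decompose symmetric v≢p leaf f f-cong (f-0 refl) δ f-corner x))
        (+-nonneg (S-preserves prune prune∈ prune-support x) remainder)
      where
      open 𝓟 A∈

      leaf : ∀ j → j ≢ v → j ≢ p → A v j ≈ 0#
      leaf j j≢v j≢p with Graph._~?_ G v j
      ... | no  v≁j = zeros v j (j≢v ∘ ≡.sym) v≁j
      ... | yes v~j = trans (symmetric v j) (A-support j v
                        λ { (inj₁ j≡v) → j≢v j≡v ; (inj₂ j∈S) → j≢p (unique j∈S v~j) })

      open Schur A positive symmetric v p v≢p leaf

      prune∈ : 𝓟 G I prune
      prune∈ = record
        { symmetric = prune-symmetric symmetric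
        ; positive  = prune-psd
        ; entries   = prune-elim {P = λ _ _ x → x ∈ I} (λ _ _ → 0∈I) (nonneg∈ e-nonneg) (λ i j _ → entries i j)
        ; zeros     = prune-elim {P = λ i j x → i ≢ j → ¬ Graph._~_ G i j → x ≈ 0#}
                        (λ _ _ _ _ → refl) (λ p≢p _ → contradiction ≡.refl p≢p) (λ i j _ → zeros i j)
        }

      prune-support : ∀ i j → i ∉ S → prune i j ≈ 0#
      prune-support = prune-elim {P = λ i j x → i ∉ S → x ≈ 0#} (λ _ _ _ → refl) (contradiction p∈S)
        λ i j i≢v i∉S → A-support i j λ { (inj₁ i≡v) → i≢v i≡v ; (inj₂ i∈S) → i∉S i∈S }

      0≤d : 0# ≤ d
      0≤d = proj₁ (proj₂ pivotInverse)

      0≤bbd : 0# ≤ b * b * d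
      0≤bbd = *-nonneg (square-nonneg b) 0≤d

      excess : ∃[ δ ] 0# ≤ δ × pow α (e + b * b * d) ≈ pow α e + pow α (b * b * d) + δ
      excess = ≤⇒difference (pow-superadditive 1≤α e-nonneg 0≤bbd)

      -- The gain f (A p p) - f e, written so that its lower bound, the power of b² d, is visible.
      δ : Carrier
      δ = pow α (b * b * d) + proj₁ excess

      f-corner : f (A p p) ≈ f e + δ
      f-corner = begin
        f (A p p)                                          ≈⟨ f-nonneg (psd-diagonal positive p) ⟩
        pow α (A p p)                                      ≈⟨ pow-cong corner ⟩
        pow α (e + b * b * d)                              ≈⟨ proj₂ (proj₂ excess) ⟩
        pow α e + pow α (b * b * d) + proj₁ excess         ≈⟨ +-assoc _ _ _ ⟩
        pow α e + δ                                        ≈⟨ +-congʳ (f-nonneg e-nonneg) ⟨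
        f e + δ                                            ∎

      -- Multiplicativity carries an inverse pivot to an inverse pivot, and the degenerate case to
      -- itself.
      f-pivotInverse : f (A v v) * f d ≈ 1# ⊎ (f b ≈ 0# × f d ≈ 0#)
      f-pivotInverse with proj₂ (proj₂ pivotInverse)
      ... | inj₂ (b≈0 , d≈0) = inj₂ (f-0 b≈0 , f-0 d≈0)
      ... | inj₁ cd≈1 = inj₁ (begin
        f (A v v) * f d           ≈⟨ *-cong (f-nonneg 0≤c) (f-nonneg 0≤d) ⟩
        pow α (A v v) * pow α d   ≈⟨ pow-* 0≤c 0≤d ⟨
        pow α (A v v * d)         ≈⟨ pow-cong cd≈1 ⟩
        pow α 1#                  ≈⟨ pow-pos (0<1) ⟩
        1# ^ α                    ≈⟨ 1^α≈1 α ⟩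
        1#                        ∎)
        where 0≤c = psd-diagonal positive v

      f-bbd≤δ : f b * f b * f d ≤ δ
      f-bbd≤δ = ≤-respˡ-≈ (begin
        pow α (b * b * d)          ≈⟨ pow-* (square-nonneg b) 0≤d ⟩
        pow α (b * b) * pow α d    ≈⟨ *-cong (f-square (entries v p)) (f-nonneg 0≤d) ⟨
        f b * f b * f d            ∎)
        (≤-+-nonneg (proj₁ (proj₂ excess)))

      remainder : 0# ≤ binaryForm (f (A v v)) (f b) δ (x v) (x p)
      remainder = binaryForm-nonneg
        (≤-respʳ-≈ (sym (f-nonneg 0≤c)) (pow-nonneg 0≤c)) f-pivotInverse f-bbd≤δ (x v) (x p)
        where 0≤c = psd-diagonal positive v

    preservesOn-⊆ : ∀ {n} {G : Graph n} {S S′} → S ⊆ S′ → PreservesOn G S′ → PreservesOn G S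
    preservesOn-⊆ S⊆S′ S′-preserves A A∈ A-support =
      S′-preserves A A∈ λ i j i∉S′ → A-support i j (i∉S′ ∘ S⊆S′)

    preservesOn-image : ∀ {m n} {G′ : Graph m} {G : Graph n} (ι : Fin m → Fin n) → Injective _≡_ _≡_ ι →
                        (∀ a b → Graph._~_ G (ι a) (ι b) → Graph._~_ G′ a b) →
                        Preserves G′ → PreservesOn G (λ w → ∃[ a ] ι a ≡ w)
    preservesOn-image {G′ = G′} ι ι-injective reflects G′-preserves A A∈ A-support x =
      ≤-respʳ-≈ (sym (form-supported (f [ A ]) f-support x)) (𝓟.positive (G′-preserves (A on ι) A′∈) (x ∘ ι))
      where
      open Embedding ι ι-injective
      open 𝓟 A∈

      A′∈ : 𝓟 G′ I (A on ι)
      A′∈ = record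
        { symmetric = λ a b → symmetric (ι a) (ι b)
        ; positive  = psd-principal positive
        ; entries   = λ a b → entries (ι a) (ι b)
        ; zeros     = λ a b a≢b a≁b → zeros (ι a) (ι b) (a≢b ∘ ι-injective) (a≁b ∘ reflects a b)
        }

      f-support : ∀ i j → i ∉Image ⊎ j ∉Image → f (A i j) ≈ 0#
      f-support i j (inj₁ i∉) = f-0 (A-support i j λ (a , eq) → i∉ a eq)
      f-support i j (inj₂ j∉) = f-0 (trans (symmetric i j) (A-support j i λ (a , eq) → j∉ a eq))

    -- By `fresh` and `neighbour` the copy of T hangs on S₀ at its root only, so a leaf met while
    -- growing T is also a leaf relative to the larger set in G.
    preservesOn-grown : 1# ≤ α → ∀ {k n} {T : Graph k} {G : Graph n} {S₀ : Pred (Fin n) 0ℓ} {r}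
      (h : Fin k → Fin n) → Injective _≡_ _≡_ h → h r ∈ S₀ → (∀ {u} → h u ∈ S₀ → u ≡ r) →
      (∀ {v w} → v ≢ r → Graph._~_ G (h v) w → ∃[ u ] Graph._~_ T v u × w ≡ h u) →
      PreservesOn G S₀ →
      ∀ {S} → Grown T r S → PreservesOn G (λ w → (∃[ u ] u ∈ᴸ S × w ≡ h u) ⊎ w ∈ S₀)
    preservesOn-grown 1≤α {T = T} {G} {S₀} {r} h h-injective hr∈S₀ fresh neighbour S₀-preserves = go
      where
      go : ∀ {S} → Grown T r S → PreservesOn G (λ w → (∃[ u ] u ∈ᴸ S × w ≡ h u) ⊎ w ∈ S₀)
      go single = preservesOn-⊆ (λ { (inj₁ (_ , here ≡.refl , ≡.refl)) → hr∈S₀ ; (inj₂ w∈S₀) → w∈S₀ }) S₀-preserves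
      go (attach {S} {v} {p} g v∉S p∈S v~p unique) = preservesOn-⊆
        (λ { (inj₁ (_ , here ≡.refl , eq)) → inj₁ eq
           ; (inj₁ (u , there u∈S , eq))   → inj₂ (inj₁ (u , u∈S , eq))
           ; (inj₂ w∈S₀)                   → inj₂ (inj₂ w∈S₀) })
        (preservesOn-leaf 1≤α (λ hv≡hp → Graph.irrefl T (h-injective hv≡hp) v~p)
          (inj₁ (p , p∈S , ≡.refl)) h-unique (go g))
        where
        r∈S : r ∈ᴸ S
        r∈S = root∈grown T g

        h-unique : ∀ {w} → (∃[ u ] u ∈ᴸ S × w ≡ h u) ⊎ w ∈ S₀ → Graph._~_ G (h v) w → w ≡ h p
        h-unique w∈ hv~w with neighbour (λ { ≡.refl → v∉S r∈S }) hv~w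
        ... | u , v~u , ≡.refl = ≡.cong h (unique (u∈S w∈) v~u)
          where
          u∈S : (∃[ u′ ] u′ ∈ᴸ S × h u ≡ h u′) ⊎ h u ∈ S₀ → u ∈ᴸ S
          u∈S (inj₁ (_ , u′∈S , eq)) with ≡.refl ← h-injective eq = u′∈S
          -- A neighbour that already lies in S₀ must be the root, which every grown set contains.
          u∈S (inj₂ hu∈S₀) with ≡.refl ← fresh hu∈S₀ = r∈S

    preservesOn-all : ∀ {n} {G : Graph n} {S} → (∀ w → w ∈ S) → PreservesOn G S → Preserves G
    preservesOn-all all S-preserves A A∈ =
      image-𝓟 A∈ (S-preserves A A∈ λ i _ i∉S → contradiction (all i) i∉S)

    preserves-attachment : 1# ≤ α → ∀ {m n} {G′ : Graph m} {G : Graph n} →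
                           TreeAttachment G′ G → Preserves G′ → Preserves G
    preserves-attachment 1≤α {G′ = G′} {G} attachment G′-preserves =
      preservesOn-all all (attach-trees (allFin _) (allFin⁺ _))
      where
      open TreeAttachment attachment
      open Gluing attachment

      Attached : List (Fin #trees) → Pred _ 0ℓ
      Attached js w = (∃[ a ] core a ≡ w) ⊎ (∃[ j ] j ∈ᴸ js × ∃[ u ] w ≡ treeVertex j u)

      all : ∀ w → w ∈ Attached (allFin #trees)
      all w with glue-surjective w
      ... | inj₁ a , ≡.refl       = inj₁ (a , ≡.refl)
      ... | inj₂ (j , u) , ≡.refl = inj₂ (j , ∈-allFin j , u , ≡.refl)

      -- Uniqueness makes the next tree differ from all those already attached, and distinct trees
      -- share at most their roots.
      attach-trees : ∀ js → Unique js → PreservesOn G (Attached js)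
      attach-trees [] _ = preservesOn-⊆ (λ { (inj₁ w∈core) → w∈core })
        (preservesOn-image core core-injective core-adjacent⁻ G′-preserves)
      attach-trees (j ∷ js) (j∉js ∷ js!) with tree-grown (T j) (isTree j) (root j)
      ... | S , grown , S-all = preservesOn-⊆
        (λ { (inj₁ w∈core)                       → inj₂ (inj₁ w∈core)
           ; (inj₂ (_ , here ≡.refl , u , eq))   → inj₁ (u , S-all u , eq)
           ; (inj₂ (i , there i∈js , u , eq))    → inj₂ (inj₂ (i , i∈js , u , eq)) })
        (preservesOn-grown 1≤α (treeVertex j) (treeVertex-injective j)
          (inj₁ (node j , treeVertex-root j)) fresh treeVertex-neighbour (attach-trees js js!) grown)
        where
        fresh : ∀ {u} → treeVertex j u ∈ Attached js → u ≡ root j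
        fresh (inj₁ (_ , eq))             = core≡treeVertex⇒root eq
        fresh (inj₂ (i , i∈js , _ , eq)) = treeVertex-distinct (All.lookup j∉js i∈js) eq

    preserves-singleton : Preserves (complete 1)
    preserves-singleton A A∈ = image-𝓟 A∈ λ x → ≤-respʳ-≈
      (solve 2 (λ a x → a :* (x :* x) := x :* a :* x :+ con 0 :+ con 0) refl (f (A 0F 0F)) (x 0F))
      (*-nonneg (≤-respʳ-≈ (sym (f-nonneg 0≤a)) (pow-nonneg 0≤a)) (square-nonneg (x 0F)))
      where 0≤a = psd-diagonal {A = A} (𝓟.positive A∈) 0F

    -- The tree is grown inside itself, with h = id, from the one-vertex graph at r.
    preserves-tree : 1# ≤ α → ∀ {n} {G : Graph n} → Fin n → IsTree G → Preserves G
    preserves-tree 1≤α {G = G} r tree with tree-grown G tree r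
    ... | S , grown , S-all = preservesOn-all (λ w → inj₁ (w , S-all w , ≡.refl))
      (preservesOn-grown 1≤α id id (0F , ≡.refl) (λ (_ , r≡u) → ≡.sym r≡u) (λ _ v~w → _ , v~w , ≡.refl)
        (preservesOn-image {G′ = complete 1} (point r) (point-injective r)
          (λ _ _ r~r → contradiction r~r (Graph.irrefl G ≡.refl)) preserves-singleton)
        grown)

    -- Passing to the subgraph G′ works for every α. The converse needs α ≥ 1, which preservation on
    -- G′ itself provides through a cherry.
    preserves-attachment-⇔ : ∀ {m n} (G′ : Graph m) (G : Graph n) → ¬ IsUnionOfK₂s G′ → TreeAttachment G′ G →
                             (Preserves G → Preserves G′) × (Preserves G′ → Preserves G)
    preserves-attachment-⇔ G′ G ¬K₂s attachment =
      preserves-subgraph core core-injective core-adjacent⁺ ,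
      λ G′-preserves → preserves-attachment
        (preserves-cherry (¬isUnionOfK₂s⇒cherry G′ ¬K₂s) G′-preserves) attachment G′-preserves
      where open Gluing attachment

  -- The three power functions

  pow-powerLike : ∀ α → PowerLike [0,∞⟩ α (pow α)
  pow-powerLike α = record
    { nonneg∈ = id
    ; cong    = pow-cong
    ; nonneg  = λ _ → refl
    ; square  = λ 0≤x → sym (pow-* 0≤x 0≤x)
    }

  -- The factor σ at negative arguments is -1 for ψ and 1 for φ; squaring removes it.
  signed-powerLike : ∀ {α f} σ → σ * σ ≈ 1# → (∀ {x} → 0# ≤ x → f x ≈ pow α x) →
                     (∀ {x} → ¬ 0# ≤ x → f x ≈ σ * pow α (- x)) → PowerLike U α f
  signed-powerLike {α} {f} σ σσ≈1 f-nonneg f-negative = record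
    { nonneg∈ = λ _ → tt
    ; cong    = f-cong
    ; nonneg  = f-nonneg
    ; square  = λ {x} _ → f-square x
    }
    where
    f-cong : ∀ {x y} → x ≈ y → f x ≈ f y
    f-cong {x} {y} x≈y with 0# ≤? x | 0# ≤? y
    ... | yes 0≤x | yes 0≤y = trans (f-nonneg 0≤x) (trans (pow-cong x≈y) (sym (f-nonneg 0≤y)))
    ... | yes 0≤x | no  0≰y = contradiction (≤-respʳ-≈ x≈y 0≤x) 0≰y
    ... | no  0≰x | yes 0≤y = contradiction (≤-respʳ-≈ (sym x≈y) 0≤y) 0≰x
    ... | no  0≰x | no  0≰y =
      trans (f-negative 0≰x) (trans (*-congˡ (pow-cong (-‿cong x≈y))) (sym (f-negative 0≰y)))

    f-square : ∀ x → f x * f x ≈ pow α (x * x)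
    f-square x with 0# ≤? x
    ... | yes 0≤x = trans (*-cong (f-nonneg 0≤x) (f-nonneg 0≤x)) (sym (pow-* 0≤x 0≤x))
    ... | no  0≰x = begin
      f x * f x                                ≈⟨ *-cong (f-negative 0≰x) (f-negative 0≰x) ⟩
      σ * pow α (- x) * (σ * pow α (- x))      ≈⟨ solve 2 (λ e p → e :* p :* (e :* p) := e :* e :* (p :* p)) refl σ (pow α (- x)) ⟩
      σ * σ * (pow α (- x) * pow α (- x))      ≈⟨ trans (*-congʳ σσ≈1) (*-identityˡ _) ⟩
      pow α (- x) * pow α (- x)                ≈⟨ pow-* 0≤-x 0≤-x ⟨
      pow α (- x * - x)                        ≈⟨ pow-cong (-x*-x≈x*x x) ⟩
      pow α (x * x)                            ∎
      where 0≤-x = -‿nonneg (≰⇒≥ 0≰x)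

  -‿pos : ∀ {x} → ¬ 0# ≤ x → 0# < - x
  -‿pos {x} 0≰x = -‿nonneg (≰⇒≥ 0≰x) , λ 0≈-x → 0≰x (≤-reflexive (begin
    0#        ≈⟨ -‿inverseʳ x ⟨
    x + - x   ≈⟨ +-congˡ 0≈-x ⟨
    x + 0#    ≈⟨ +-identityʳ x ⟩
    x         ∎))

  ψ-powerLike : ∀ α → PowerLike U α (ψ α)
  ψ-powerLike α = signed-powerLike (- 1#) (trans (-x*-x≈x*x 1#) (*-identityˡ 1#)) ψ-nonneg ψ-negative
    where
    ψ-nonneg : ∀ {x} → 0# ≤ x → ψ α x ≈ pow α x
    ψ-nonneg {x} 0≤x with x ≈? 0# | 0# ≤? x
    ... | yes _ | _       = refl
    ... | no _  | yes _   = *-identityˡ _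
    ... | no _  | no  0≰x = contradiction 0≤x 0≰x

    ψ-negative : ∀ {x} → ¬ 0# ≤ x → ψ α x ≈ - 1# * pow α (- x)
    ψ-negative {x} 0≰x with x ≈? 0# | 0# ≤? x
    ... | yes x≈0 | _       = contradiction (≤-reflexive (sym x≈0)) 0≰x
    ... | no _    | yes 0≤x = contradiction 0≤x 0≰x
    ... | no _    | no  _   = *-congˡ (sym (pow-pos (-‿pos 0≰x)))

  φ-powerLike : ∀ α → PowerLike U α (φ α)
  φ-powerLike α = signed-powerLike 1# (*-identityˡ 1#) φ-nonneg φ-negative
    where
    φ-nonneg : ∀ {x} → 0# ≤ x → φ α x ≈ pow α x
    φ-nonneg {x} 0≤x with x ≈? 0# | 0# ≤? x
    ... | yes _ | _       = refl
    ... | no _  | yes _   = refl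
    ... | no _  | no  0≰x = contradiction 0≤x 0≰x

    φ-negative : ∀ {x} → ¬ 0# ≤ x → φ α x ≈ 1# * pow α (- x)
    φ-negative {x} 0≰x with x ≈? 0# | 0# ≤? x
    ... | yes x≈0 | _       = contradiction (≤-reflexive (sym x≈0)) 0≰x
    ... | no _    | yes 0≤x = contradiction 0≤x 0≰x
    ... | no _    | no  _   = trans (sym (pow-pos (-‿pos 0≰x))) (sym (*-identityˡ _))

theorem2p2 : ∀ {c ℓ} (ℝ : RealNumbers c ℓ) →
    let open RealNumbers ℝ using (1#)
        open EntrywisePowers ℝ in
    (∀ {m n : ℕ} (G′ : Graph m) (G : Graph n) →
      ¬ IsUnionOfK₂s G′ →
      (∃[ v ] ¬ Isolated G′ v) →
      TreeAttachment G′ G →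
      (𝓗 G ≐ 𝓗 G′) × (𝓗ψ G ≐ 𝓗ψ G′) × (𝓗φ G ≐ 𝓗φ G′))
    ×
    (∀ {n : ℕ} (G : Graph n) → 3 ≤ℕ n → IsTree G →
      IsCE-H G 1# × IsCE-Hφ G 1# × IsCE-Hψ G 1#)
theorem2p2 {c} {ℓ} ℝ = attachments , trees
  where
  open RealNumbers ℝ using (Carrier; 1#; _≤_; isDecTotalOrder)
  open IsDecTotalOrder isDecTotalOrder using () renaming (refl to ≤-refl)
  open EntrywisePowers ℝ

  attachments : ∀ {m n : ℕ} (G′ : Graph m) (G : Graph n) → ¬ IsUnionOfK₂s G′ →
    (∃[ v ] ¬ Isolated G′ v) → TreeAttachment G′ G →
    (𝓗 G ≐ 𝓗 G′) × (𝓗ψ G ≐ 𝓗ψ G′) × (𝓗φ G ≐ 𝓗φ G′)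
  attachments G′ G ¬K₂s _ attachment =
    equal (pow-powerLike ℝ) , equal (ψ-powerLike ℝ) , equal (φ-powerLike ℝ)
    where
    equal : ∀ {i} {I : Pred Carrier i} {f : Carrier → Carrier → Carrier} → (∀ α → PowerLike ℝ I α (f α)) →
            (λ α → ∀ A → 𝓟 G I A → 𝓟 G U (f α [ A ])) ≐ (λ α → ∀ A → 𝓟 G′ I A → 𝓟 G′ U (f α [ A ]))
    equal powerLike =
      (λ {α} → proj₁ (Preservation.preserves-attachment-⇔ ℝ (powerLike α) G′ G ¬K₂s attachment)) ,
      (λ {α} → proj₂ (Preservation.preserves-attachment-⇔ ℝ (powerLike α) G′ G ¬K₂s attachment))

  trees : ∀ {n : ℕ} (G : Graph n) → 3 ≤ℕ n → IsTree G →
          IsCE-H G 1# × IsCE-Hφ G 1# × IsCE-Hψ G 1#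
  -- The match exposes n as a successor, so that vertex `zero` can serve as the root.
  trees G 3≤n@(s≤s _) tree =
    critical (pow-powerLike ℝ) , critical (φ-powerLike ℝ) , critical (ψ-powerLike ℝ)
    where
    critical : ∀ {i} {I : Pred Carrier i} {f : Carrier → Carrier → Carrier} → (∀ α → PowerLike ℝ I α (f α)) →
               let S = λ α → ∀ β → α ≤ β → ∀ A → 𝓟 G I A → 𝓟 G U (f β [ A ]) in
               S 1# × (∀ α → S α → 1# ≤ α)
    critical powerLike =
      (λ β 1≤β → Preservation.preserves-tree ℝ (powerLike β) 1≤β zero tree) ,
      -- Every admissible threshold is itself a preserving exponent, so the cherry bounds it from
      -- below.
      (λ α α∈S → Preservation.preserves-cherry ℝ (powerLike α)
        (connected⇒cherry G 3≤n (IsTree.connected tree)) (α∈S α ≤-refl))
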